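{- Let $\mathbf{M}$ be a matroid representable over a field of characteristic zero, with ground set $E$ and rank function $r$. Let $A,B \subseteq E$ with $|A|=|B|=r(E)$, and let $X \subseteq A \setminus B$ and $Y \subseteq B \setminus A$ be subsets such that $r(X\cup Y) < |A \setminus B|$. Suppose there exists exactly one pair $(U,V)$ with $U \subseteq A \setminus B$ and $V\subseteq B \setminus A$ such that $X \subseteq U$, $Y \subseteq V$, $|U| = |V| \le r(X\cup Y)$, and both $(A\setminus U)\cup V$ and $(B\setminus V)\cup U$ are bases of $\mathbf{M}$. Then $A$ and $B$ are bases of $\mathbf{M}$.
   Context: A matroid on ground set identified with $[n]$ is representable over a field $\mathbb{F}$ if there is a matrix $M\in\mathbb{F}^{r\times n}$ such that the bases are exactly the sets $B$ for which the column submatrix $M[B]$ is square and nonsingular. The rank function is $r(S)=\max\{|S\cap B|: B \text{ a basis}\}$. -}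

module Defs where

open import Level using (Level; _⊔_)
open import Data.Nat as ℕ using (ℕ; zero; suc; _<_; _≤_)
open import Data.Fin using (Fin; zero; suc; punchIn; cast)
open import Data.Fin.Subset using (Subset; ∣_∣; _∩_; inside; outside)
open import Data.List using (List; []; _∷_; length; lookup; map)
open import Data.Vec using ([]; _∷_)
open import Data.Product using (Σ; ∃; _×_)
open import Relation.Binary.PropositionalEquality using (_≡_; sym)
open import Relation.Nullary using (¬_)
open import Algebra.Bundles using (CommutativeRing)
import Algebra.Definitions.RawMonoid as RM

record Field (c ℓ : Level) : Set (Level.suc (c ⊔ ℓ)) where
  field
    commutativeRing : CommutativeRing c ℓ
  open CommutativeRing commutativeRing public
  field
    0≉1     : ¬ (0# ≈ 1#)
    inverse : ∀ x → ¬ (x ≈ 0#) → Σ Carrier λ y → x * y ≈ 1#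

module _ {c ℓ} (F : Field c ℓ) where
  open Field F
  open RM +-rawMonoid using () renaming (_×_ to _·_)

  CharZero : Set ℓ
  CharZero = ∀ (n : ℕ) → n · 1# ≈ 0# → n ≡ 0

module Det {c ℓ} (F : Field c ℓ) where
  open Field F using (Carrier; _+_; _*_; -_; 1#; +-rawMonoid)
  open RM +-rawMonoid using (sum)

  alt : ℕ → Carrier → Carrier
  alt zero    x = x
  alt (suc j) x = - alt j x

  toℕ' : ∀ {n} → Fin n → ℕ
  toℕ' zero    = zero
  toℕ' (suc i) = suc (toℕ' i)

  det : ∀ {k} → (Fin k → Fin k → Carrier) → Carrier
  det {zero}  M = 1#
  det {suc k} M =
    sum λ j → alt (toℕ' j) (M zero j * det (λ a b → M (suc a) (punchIn j b)))

elems : ∀ {n} → Subset n → List (Fin n)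
elems {zero}  []            = []
elems {suc n} (inside ∷ s)  = zero ∷ map suc (elems s)
elems {suc n} (outside ∷ s) = map suc (elems s)

module Represented {c ℓ} (F : Field c ℓ) {r n : ℕ}
                   (M : Fin r → Fin n → Field.Carrier F) where
  open Field F using (Carrier; _≈_; 0#)
  open Det F

  IsBasis : Subset n → Set ℓ
  IsBasis B = Σ (length (elems B) ≡ r) λ eq →
    ¬ (det (λ i j → M i (lookup (elems B) (cast (sym eq) j))) ≈ 0#)

  IsRank : Subset n → ℕ → Set ℓ
  IsRank S k = (Σ (Subset n) λ B → IsBasis B × (∣ S ∩ B ∣ ≡ k))
             × (∀ B → IsBasis B → ∣ S ∩ B ∣ ≤ k)

{-# OPTIONS --safe #-}
module Submission where

-- For S a set of columns let [S] be the determinant of its columns, which is 0 unless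
-- ∣S∣ = r. Work in the exterior algebra of F^r ⊕ F^r, where a column v gives
-- the vectors top v = (v , 0), bot v = (0 , v) and diag v = top v + bot v. Up to sign, the
-- leading coefficient of the product of the top's of S and the bot's of T is [S] [T], and
-- replacing the top's of S by diag's does not change it, because the substitution
-- (e , f) ↦ (e + f , f) of basis vectors is unimodular.
--
-- Let term U V be ± [(A ─ U) ∪ V] [(B ─ V) ∪ U] if X ⊆ U ⊆ A ─ B and Y ⊆ V ⊆ B ─ A, and 0
-- otherwise. Its sum over all V and all U ⊇ W is the leading coefficient of a product of
-- vectors. Rewritten in terms of diag and bot, only columns of X ∪ Y ∪ W ∪ (A ∩ B) occur
-- with a bot, so it is a combination of [S] [T] with T inside that set; if
-- ∣W∣ < ∣A ─ B∣ - r(X ∪ Y), then no such T is a basis, and the sum vanishes.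
-- Consequently ∑ H(∣U∣) term U V = 0 for every product H of fewer than
-- ∣A ─ B∣ - r(X ∪ Y) linear factors. Choosing the zeros of H at r(X ∪ Y) < u < ∣A ─ B∣
-- leaves ± [B] [A], from U = A ─ B, and the terms with ∣U∣ ≤ r(X ∪ Y). In characteristic
-- zero H has no further zero there, so if [A] [B] = 0, the only term left must vanish too.

open import Defs
open import Level using (_⊔_)
open import Data.Nat as ℕ using (ℕ; zero; suc; _<_; _≤_)
open import Data.Bool using (Bool; true; false; _∧_; _∨_; not)
open import Data.Fin using (Fin; zero; suc; punchIn; cast)
open import Data.Fin.Subset using (Subset; ∣_∣; _⊆_; _∪_; _∩_; _─_; ⊤; ⊥; inside; outside)
open import Data.Integer as ℤ using (ℤ; +_; -[1+_]; _⊖_)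
import Data.Integer.Properties as ℤₚ
import Data.Sign as Sign
open import Data.List using (List; []; _∷_; length; lookup; foldr)
open import Data.Maybe using (Maybe; just; nothing)
open import Data.Product using (Σ; _×_; _,_; proj₁; proj₂)
open import Data.Sum using (_⊎_; inj₁; inj₂)
open import Function using (_∘_)
open import Relation.Binary.PropositionalEquality as ≡ using (_≡_)
open import Relation.Nullary using (¬_; yes; no; contradiction)
open import Algebra.Bundles using (CommutativeRing)
open import Algebra.Solver.Ring.AlmostCommutativeRing using (fromCommutativeRing; _-Raw-AlmostCommutative⟶_)
import Algebra.Solver.Ring
import Algebra.Properties.Ring
import Algebra.Properties.AbelianGroup
import Algebra.Properties.Semiring.Mult.TCOptimised
import Algebra.Properties.Semiring.Mult
import Algebra.Properties.Semiring.Sum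
import Relation.Binary.Reasoning.Setoid
open import Data.Fin.Subset.Properties using (∣⊤∣≡n; ∣⊥∣≡0; ∩-identityˡ; ∩-comm; p⊆q⇒∣p∣≤∣q∣; p─q⊆p; out⊆; in⊆in; drop-∷-⊆; ⊆-refl; x∈p∪q⁻; x∈p∪q⁺; x∈p∩q⁺)
open import Data.List.Properties using (foldr-map; length-map)
import Data.Nat.Properties as ℕₚ
open import Data.Vec using ([]; _∷_; head; here)
open import Data.Vec.Properties using (∷-injectiveʳ)

-- Ring identities with integer coefficients.

module IntegerSolver {c ℓ} (R : CommutativeRing c ℓ) where
  open CommutativeRing R
  open Algebra.Properties.Ring ring
  open Algebra.Properties.AbelianGroup +-abelianGroup using (⁻¹-∙-comm)
  open Algebra.Properties.Semiring.Mult.TCOptimised semiring using (×-homo-+; ×1-homo-*; 1+×) renaming (_×_ to _·_)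
  open Relation.Binary.Reasoning.Setoid setoid

  -- Equality in `R` need not be decidable, so the solver compares coefficients in ℤ. The optimised
  -- multiples make `⟦ + 1 ⟧` reduce to `1#`, so that `con (+ 1)` and `con -[1+ 0 ]` stand literally
  -- for `1#` and `- 1#`.
  ⟦_⟧ : ℤ → Carrier
  ⟦ + n ⟧      = n · 1#
  ⟦ -[1+ n ] ⟧ = - (suc n · 1#)

  ⊖-homo : ∀ m n → ⟦ m ⊖ n ⟧ ≈ m · 1# - n · 1#
  ⊖-homo zero zero = sym (-‿inverseʳ 0#)
  ⊖-homo zero (suc n) = sym (+-identityˡ _)
  ⊖-homo (suc m) zero = sym (trans (+-congˡ -0#≈0#) (+-identityʳ _))
  ⊖-homo (suc m) (suc n) = begin
    ⟦ suc m ⊖ suc n ⟧                      ≡⟨ ≡.cong ⟦_⟧ (ℤₚ.[1+m]⊖[1+n]≡m⊖n m n) ⟩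
    ⟦ m ⊖ n ⟧                              ≈⟨ ⊖-homo m n ⟩
    m · 1# - n · 1#                        ≈⟨ +-congˡ (+-identityˡ _) ⟨
    m · 1# + (0# - n · 1#)                 ≈⟨ +-congˡ (+-congʳ (-‿inverseʳ 1#)) ⟨
    m · 1# + (1# - 1# - n · 1#)            ≈⟨ +-congˡ (+-assoc _ _ _) ⟩
    m · 1# + (1# + (- 1# - n · 1#))        ≈⟨ +-assoc _ _ _ ⟨
    m · 1# + 1# + (- 1# - n · 1#)          ≈⟨ +-cong (+-comm _ _) (⁻¹-∙-comm _ _) ⟩
    1# + m · 1# - (1# + n · 1#)            ≈⟨ +-cong (1+× m 1#) (-‿cong (1+× n 1#)) ⟨
    suc m · 1# - suc n · 1#                ∎

  -◃-homo : ∀ n → ⟦ Sign.- ℤ.◃ n ⟧ ≈ - (n · 1#)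
  -◃-homo zero    = sym -0#≈0#
  -◃-homo (suc n) = refl

  +◃-homo : ∀ n → ⟦ Sign.+ ℤ.◃ n ⟧ ≈ n · 1#
  +◃-homo zero    = refl
  +◃-homo (suc n) = refl

  +-homo : ∀ i j → ⟦ i ℤ.+ j ⟧ ≈ ⟦ i ⟧ + ⟦ j ⟧
  +-homo (+ m)    (+ n)    = ×-homo-+ 1# m n
  +-homo (+ m)    -[1+ n ] = ⊖-homo m (suc n)
  +-homo -[1+ m ] (+ n)    = trans (⊖-homo n (suc m)) (+-comm _ _)
  +-homo -[1+ m ] -[1+ n ] = begin
    - (suc (suc (m ℕ.+ n)) · 1#)       ≡⟨ ≡.cong (λ k → - (k · 1#)) (ℕₚ.+-suc (suc m) n) ⟨
    - ((suc m ℕ.+ suc n) · 1#)         ≈⟨ -‿cong (×-homo-+ 1# (suc m) (suc n)) ⟩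
    - (suc m · 1# + suc n · 1#)        ≈⟨ ⁻¹-∙-comm _ _ ⟨
    - (suc m · 1#) - suc n · 1#        ∎
    where import Data.Nat.Properties as ℕₚ

  *-homo : ∀ i j → ⟦ i ℤ.* j ⟧ ≈ ⟦ i ⟧ * ⟦ j ⟧
  *-homo (+ m)    (+ n)    = trans (+◃-homo (m ℕ.* n)) (×1-homo-* m n)
  *-homo (+ m)    -[1+ n ] = trans (-◃-homo (m ℕ.* suc n)) (trans (-‿cong (×1-homo-* m (suc n))) (-‿distribʳ-* _ _))
  *-homo -[1+ m ] (+ n)    = trans (-◃-homo (suc m ℕ.* n)) (trans (-‿cong (×1-homo-* (suc m) n)) (-‿distribˡ-* _ _))
  *-homo -[1+ m ] -[1+ n ] = begin
    (suc m ℕ.* suc n) · 1#               ≈⟨ ×1-homo-* (suc m) (suc n) ⟩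
    suc m · 1# * (suc n · 1#)            ≈⟨ -‿involutive _ ⟨
    - - (suc m · 1# * (suc n · 1#))      ≈⟨ -‿cong (-‿distribʳ-* _ _) ⟩
    - (suc m · 1# * - (suc n · 1#))      ≈⟨ -‿distribˡ-* _ _ ⟩
    - (suc m · 1#) * - (suc n · 1#)      ∎

  -‿homo : ∀ i → ⟦ ℤ.- i ⟧ ≈ - ⟦ i ⟧
  -‿homo (+ zero)  = sym -0#≈0#
  -‿homo (+ suc n) = refl
  -‿homo -[1+ n ]  = sym (-‿involutive _)

  morphism : ℤ.+-*-rawRing -Raw-AlmostCommutative⟶ fromCommutativeRing R
  morphism = record
    { ⟦_⟧ = ⟦_⟧ ; +-homo = +-homo ; *-homo = *-homo ; -‿homo = -‿homo
    ; 0-homo = refl ; 1-homo = refl }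

  ⟦⟧-≟ : ∀ i j → Maybe (⟦ i ⟧ ≈ ⟦ j ⟧)
  ⟦⟧-≟ i j with i ℤ.≟ j
  ... | yes i≡j = just (reflexive (≡.cong ⟦_⟧ i≡j))
  ... | no  _   = nothing

  open Algebra.Solver.Ring ℤ.+-*-rawRing (fromCommutativeRing R) morphism ⟦⟧-≟ public
    using (solve; _:=_; _:+_; _:*_; _:-_; :-_; con)

-- The exterior algebras of F^k and of F^k ⊕ F^k.

module Exterior {c ℓ} (F : Field c ℓ) where
  open Field F hiding (zero)
  open IntegerSolver commutativeRing using (solve; _:=_; _:+_; _:*_; _:-_; :-_; con)
  open Relation.Binary.Reasoning.Setoid setoid

  infix 4 _≋_
  _≋_ : {I : Set} → (I → Carrier) → (I → Carrier) → Set ℓ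
  x ≋ y = ∀ i → x i ≈ y i

  -- With additivity and homogeneity in one axiom, each operator needs a single induction. Of the
  -- derived forms, `axpy` matches the `inside` clause of `W`.
  record IsLinear {I J : Set} (L : (I → Carrier) → J → Carrier) : Set (c ⊔ ℓ) where
    field
      cong : ∀ {x y} → x ≋ y → L x ≋ L y
      comb : ∀ a b x y → L (λ i → a * x i + b * y i) ≋ (λ j → a * L x j + b * L y j)

    zero-homo : ∀ {x} → x ≋ (λ _ → 0#) → L x ≋ (λ _ → 0#)
    zero-homo {x} x≋0 j = begin
      L x j                              ≈⟨ cong (λ i → trans (x≋0 i) (solve 1 (λ u → con (+ 0) := con (+ 0) :* u :+ con (+ 0) :* u) refl (x i))) j ⟩
      L (λ i → 0# * x i + 0# * x i) j    ≈⟨ comb 0# 0# x x j ⟩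
      0# * L x j + 0# * L x j            ≈⟨ solve 1 (λ u → con (+ 0) :* u :+ con (+ 0) :* u := con (+ 0)) refl (L x j) ⟩
      0#                                 ∎

    +-homo : ∀ x y → L (λ i → x i + y i) ≋ (λ j → L x j + L y j)
    +-homo x y j = begin
      L (λ i → x i + y i) j              ≈⟨ cong (λ i → +-cong (sym (*-identityˡ _)) (sym (*-identityˡ _))) j ⟩
      L (λ i → 1# * x i + 1# * y i) j    ≈⟨ comb 1# 1# x y j ⟩
      1# * L x j + 1# * L y j            ≈⟨ +-cong (*-identityˡ _) (*-identityˡ _) ⟩
      L x j + L y j                      ∎

    axpy : ∀ a x y → L (λ i → a * x i - y i) ≋ (λ j → a * L x j - L y j)
    axpy a x y j = begin
      L (λ i → a * x i - y i) j            ≈⟨ cong (λ i → solve 3 (λ a x y → a :* x :- y := a :* x :+ con -[1+ 0 ] :* y) refl a (x i) (y i)) j ⟩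
      L (λ i → a * x i + - 1# * y i) j     ≈⟨ comb a (- 1#) x y j ⟩
      a * L x j + - 1# * L y j             ≈⟨ solve 3 (λ a x y → a :* x :+ con -[1+ 0 ] :* y := a :* x :- y) refl a (L x j) (L y j) ⟩
      a * L x j - L y j                    ∎

    *-homo : ∀ a x → L (λ i → a * x i) ≋ (λ j → a * L x j)
    *-homo a x j = begin
      L (λ i → a * x i) j                ≈⟨ cong (λ i → solve 2 (λ a x → a :* x := a :* x :+ con (+ 0) :* x) refl a (x i)) j ⟩
      L (λ i → a * x i + 0# * x i) j     ≈⟨ comb a 0# x x j ⟩
      a * L x j + 0# * L x j             ≈⟨ solve 2 (λ a x → a :* x :+ con (+ 0) :* x := a :* x) refl a (L x j) ⟩
      a * L x j                          ∎

    neg-homo : ∀ x → L (λ i → - x i) ≋ (λ j → - L x j)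
    neg-homo x j = begin
      L (λ i → - x i) j                  ≈⟨ cong (λ i → solve 1 (λ x → :- x := con (+ 0) :* x :- x) refl (x i)) j ⟩
      L (λ i → 0# * x i - x i) j         ≈⟨ axpy 0# x x j ⟩
      0# * L x j - L x j                 ≈⟨ solve 1 (λ x → con (+ 0) :* x :- x := :- x) refl (L x j) ⟩
      - L x j                            ∎

  V : ℕ → Set c
  V k = Fin k → Carrier

  -- The exterior algebra of F^k: x S is the coefficient of the product of the
  -- basis vectors indexed by S, in increasing order.
  Λ : ℕ → Set c
  Λ k = Subset k → Carrier

  -- Left multiplication by v.
  W : ∀ {k} → V k → Λ k → Λ k
  W v x []            = 0#
  W v x (outside ∷ S) = W (v ∘ suc) (x ∘ (outside ∷_)) S
  W v x (inside ∷ S)  = v zero * x (outside ∷ S) - W (v ∘ suc) (x ∘ (inside ∷_)) S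

  W-cong : ∀ {k} (v : V k) {x y} → x ≋ y → W v x ≋ W v y
  W-cong v x≋y []            = refl
  W-cong v x≋y (outside ∷ S) = W-cong (v ∘ suc) (x≋y ∘ (outside ∷_)) S
  W-cong v x≋y (inside ∷ S)  = +-cong (*-congˡ (x≋y _)) (-‿cong (W-cong (v ∘ suc) (x≋y ∘ (inside ∷_)) S))

  W-linear : ∀ {k} (v : V k) → IsLinear (W v)
  W-linear v = record { cong = W-cong v ; comb = comb v }
    where
    comb : ∀ {k} (v : V k) a b x y → W v (λ i → a * x i + b * y i) ≋ (λ j → a * W v x j + b * W v y j)
    comb v a b x y []            = solve 2 (λ a b → con (+ 0) := a :* con (+ 0) :+ b :* con (+ 0)) refl a b
    comb v a b x y (outside ∷ S) = comb (v ∘ suc) a b (x ∘ (outside ∷_)) (y ∘ (outside ∷_)) S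
    comb v a b x y (inside ∷ S)  = trans
      (+-congˡ (-‿cong (comb (v ∘ suc) a b (x ∘ (inside ∷_)) (y ∘ (inside ∷_)) S)))
      (solve 7 (λ v a b x y x′ y′ → v :* (a :* x :+ b :* y) :- (a :* x′ :+ b :* y′)
          := a :* (v :* x :- x′) :+ b :* (v :* y :- y′)) refl
        (v zero) a b (x (outside ∷ S)) (y (outside ∷ S)) _ _)

  sgn : ∀ {k} → Subset k → Carrier
  sgn []            = 1#
  sgn (outside ∷ S) = sgn S
  sgn (inside ∷ S)  = - sgn S

  -- The grade involution: the sign by which a product changes when a vector is moved past it.
  bar : ∀ {k} → Λ k → Λ k
  bar x S = sgn S * x S

  -- Multiplication by a vector raises the degree by one, so it anticommutes with the grade
  -- involution.
  W-bar : ∀ {k} (v : V k) x → W v (bar x) ≋ (λ S → - bar (W v x) S)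
  W-bar v x []            = solve 0 (con (+ 0) := :- (con (+ 1) :* con (+ 0))) refl
  W-bar v x (outside ∷ S) = W-bar (v ∘ suc) (x ∘ (outside ∷_)) S
  W-bar v x (inside ∷ S)  = begin
    v zero * (sgn S * x (outside ∷ S)) - W (v ∘ suc) (λ S → - sgn S * x (inside ∷ S)) S
      ≈⟨ +-congˡ (-‿cong (trans (W-cong (v ∘ suc) (λ S → solve 2 (λ s x → :- s :* x := :- (s :* x)) refl (sgn S) (x (inside ∷ S))) S)
           (trans (IsLinear.neg-homo (W-linear (v ∘ suc)) (bar (x ∘ (inside ∷_))) S)
             (-‿cong (W-bar (v ∘ suc) (x ∘ (inside ∷_)) S))))) ⟩
    v zero * (sgn S * x (outside ∷ S)) - (- - (sgn S * W (v ∘ suc) (x ∘ (inside ∷_)) S))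
      ≈⟨ solve 4 (λ v s x w → v :* (s :* x) :- (:- :- (s :* w)) := :- (:- s :* (v :* x :- w))) refl (v zero) (sgn S) (x (outside ∷ S)) (W (v ∘ suc) (x ∘ (inside ∷_)) S) ⟩
    - (- sgn S * (v zero * x (outside ∷ S) - W (v ∘ suc) (x ∘ (inside ∷_)) S)) ∎

  W-W : ∀ {k} (v : V k) x → W v (W v x) ≋ (λ _ → 0#)
  W-W v x []            = refl
  W-W v x (outside ∷ S) = W-W (v ∘ suc) (x ∘ (outside ∷_)) S
  W-W v x (inside ∷ S)  = trans
    (+-congˡ (-‿cong (trans (IsLinear.axpy (W-linear (v ∘ suc)) (v zero) (x ∘ (outside ∷_)) (W (v ∘ suc) (x ∘ (inside ∷_))) S)
      (+-congˡ (-‿cong (W-W (v ∘ suc) (x ∘ (inside ∷_)) S))))))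
    (solve 2 (λ v w → v :* w :- (v :* w :- con (+ 0)) := con (+ 0)) refl (v zero) (W (v ∘ suc) (x ∘ (outside ∷_)) S))

  -- The exterior algebra of F^k ⊕ F^k, with the two copies e and f of the standard
  -- basis interleaved as e₀, f₀, e₁, f₁, …
  Λ² : ℕ → Set c
  Λ² k = Subset k × Subset k → Carrier

  part : ∀ {k} → Bool → Bool → Λ² (suc k) → Λ² k
  part s t z (S , T) = z (s ∷ S , t ∷ T)

  -- Left multiplication by (l , r), that is by ∑ lᵢ eᵢ + rᵢ fᵢ.
  G : ∀ {k} → V k → V k → Λ² k → Λ² k
  G l r z ([] , [])                       = 0#
  G l r z (outside ∷ S , outside ∷ T) = G (l ∘ suc) (r ∘ suc) (part outside outside z) (S , T)
  G l r z (inside ∷ S , outside ∷ T)  =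
    l zero * z (outside ∷ S , outside ∷ T) - G (l ∘ suc) (r ∘ suc) (part inside outside z) (S , T)
  G l r z (outside ∷ S , inside ∷ T)  =
    r zero * z (outside ∷ S , outside ∷ T) - G (l ∘ suc) (r ∘ suc) (part outside inside z) (S , T)
  G l r z (inside ∷ S , inside ∷ T)   =
    l zero * z (outside ∷ S , inside ∷ T) - r zero * z (inside ∷ S , outside ∷ T)
      + G (l ∘ suc) (r ∘ suc) (part inside inside z) (S , T)

  G-cong : ∀ {k} {l l′ r r′ : V k} → l ≋ l′ → r ≋ r′ → ∀ {z z′} → z ≋ z′ → G l r z ≋ G l′ r′ z′
  G-cong l≋ r≋ z≋ ([] , [])                   = refl
  G-cong l≋ r≋ z≋ (outside ∷ S , outside ∷ T) = G-cong (l≋ ∘ suc) (r≋ ∘ suc) (λ _ → z≋ _) (S , T)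
  G-cong l≋ r≋ z≋ (inside ∷ S , outside ∷ T)  =
    +-cong (*-cong (l≋ zero) (z≋ _)) (-‿cong (G-cong (l≋ ∘ suc) (r≋ ∘ suc) (λ _ → z≋ _) (S , T)))
  G-cong l≋ r≋ z≋ (outside ∷ S , inside ∷ T)  =
    +-cong (*-cong (r≋ zero) (z≋ _)) (-‿cong (G-cong (l≋ ∘ suc) (r≋ ∘ suc) (λ _ → z≋ _) (S , T)))
  G-cong l≋ r≋ z≋ (inside ∷ S , inside ∷ T)   =
    +-cong (+-cong (*-cong (l≋ zero) (z≋ _)) (-‿cong (*-cong (r≋ zero) (z≋ _))))
      (G-cong (l≋ ∘ suc) (r≋ ∘ suc) (λ _ → z≋ _) (S , T))

  G-linear : ∀ {k} (l r : V k) → IsLinear (G l r)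
  G-linear l r = record { cong = G-cong (λ _ → refl) (λ _ → refl) ; comb = comb l r }
    where
    comb : ∀ {k} (l r : V k) a b x y → G l r (λ i → a * x i + b * y i) ≋ (λ j → a * G l r x j + b * G l r y j)
    comb l r a b x y ([] , []) = solve 2 (λ a b → con (+ 0) := a :* con (+ 0) :+ b :* con (+ 0)) refl a b
    comb l r a b x y (outside ∷ S , outside ∷ T) = comb (l ∘ suc) (r ∘ suc) a b _ _ (S , T)
    comb l r a b x y (inside ∷ S , outside ∷ T) = trans
      (+-congˡ (-‿cong (comb (l ∘ suc) (r ∘ suc) a b _ _ (S , T))))
      (solve 7 (λ v a b x y x′ y′ → v :* (a :* x :+ b :* y) :- (a :* x′ :+ b :* y′)
          := a :* (v :* x :- x′) :+ b :* (v :* y :- y′)) refl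
        (l zero) a b (x (outside ∷ S , outside ∷ T)) (y (outside ∷ S , outside ∷ T)) _ _)
    comb l r a b x y (outside ∷ S , inside ∷ T) = trans
      (+-congˡ (-‿cong (comb (l ∘ suc) (r ∘ suc) a b _ _ (S , T))))
      (solve 7 (λ v a b x y x′ y′ → v :* (a :* x :+ b :* y) :- (a :* x′ :+ b :* y′)
          := a :* (v :* x :- x′) :+ b :* (v :* y :- y′)) refl
        (r zero) a b (x (outside ∷ S , outside ∷ T)) (y (outside ∷ S , outside ∷ T)) _ _)
    comb l r a b x y (inside ∷ S , inside ∷ T) = trans
      (+-congˡ (comb (l ∘ suc) (r ∘ suc) a b _ _ (S , T)))
      (solve 10 (λ l r a b x y x′ y′ p q → l :* (a :* x :+ b :* y) :- r :* (a :* x′ :+ b :* y′) :+ (a :* p :+ b :* q)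
          := a :* (l :* x :- r :* x′ :+ p) :+ b :* (l :* y :- r :* y′ :+ q)) refl
        (l zero) (r zero) a b (x (outside ∷ S , inside ∷ T)) (y (outside ∷ S , inside ∷ T))
        (x (inside ∷ S , outside ∷ T)) (y (inside ∷ S , outside ∷ T)) _ _)

  𝟘 : ∀ {k} → V k
  𝟘 _ = 0#

  -- Multiplication is additive in the vector, and (v , v) = (v , 0) + (0 , v).
  G-diag : ∀ {k} (v : V k) z → G v v z ≋ (λ p → G v 𝟘 z p + G 𝟘 v z p)
  G-diag v z ([] , []) = sym (+-identityʳ 0#)
  G-diag v z (outside ∷ S , outside ∷ T) = G-diag (v ∘ suc) _ (S , T)
  G-diag v z (inside ∷ S , outside ∷ T) = trans
    (+-congˡ (-‿cong (G-diag (v ∘ suc) _ (S , T))))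
    (solve 4 (λ v z g h → v :* z :- (g :+ h) := v :* z :- g :+ (con (+ 0) :* z :- h)) refl (v zero) (z (outside ∷ S , outside ∷ T)) _ _)
  G-diag v z (outside ∷ S , inside ∷ T) = trans
    (+-congˡ (-‿cong (G-diag (v ∘ suc) _ (S , T))))
    (solve 4 (λ v z g h → v :* z :- (g :+ h) := con (+ 0) :* z :- g :+ (v :* z :- h)) refl (v zero) (z (outside ∷ S , outside ∷ T)) _ _)
  G-diag v z (inside ∷ S , inside ∷ T) = trans
    (+-congˡ (G-diag (v ∘ suc) _ (S , T)))
    (solve 5 (λ v z y g h → v :* z :- v :* y :+ (g :+ h) := v :* z :- con (+ 0) :* y :+ g :+ (con (+ 0) :* z :- v :* y :+ h)) refl
      (v zero) (z (outside ∷ S , inside ∷ T)) (z (inside ∷ S , outside ∷ T)) _ _)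

  -- μ s x y is the product of x and y, where x is expressed in the vectors
  -- e₀ + s f₀, e₁ + s f₁, … and y in f₀, f₁, …
  μ : ∀ {k} → Carrier → Λ k → Λ k → Λ² k
  μ s x y ([] , [])                   = x [] * y []
  μ s x y (outside ∷ S , outside ∷ T) = μ s (x ∘ (outside ∷_)) (y ∘ (outside ∷_)) (S , T)
  μ s x y (inside ∷ S , outside ∷ T)  = μ s (x ∘ (inside ∷_)) (y ∘ (outside ∷_)) (S , T)
  μ s x y (outside ∷ S , inside ∷ T)  =
    s * μ s (x ∘ (inside ∷_)) (y ∘ (outside ∷_)) (S , T) + μ s (bar (x ∘ (outside ∷_))) (y ∘ (inside ∷_)) (S , T)
  μ s x y (inside ∷ S , inside ∷ T)   = μ s (bar (x ∘ (inside ∷_))) (y ∘ (inside ∷_)) (S , T)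

  μ-cong : ∀ {k} s {x x′ y y′ : Λ k} → x ≋ x′ → y ≋ y′ → μ s x y ≋ μ s x′ y′
  μ-cong s x≋ y≋ ([] , [])                   = *-cong (x≋ []) (y≋ [])
  μ-cong s x≋ y≋ (outside ∷ S , outside ∷ T) = μ-cong s (λ _ → x≋ _) (λ _ → y≋ _) (S , T)
  μ-cong s x≋ y≋ (inside ∷ S , outside ∷ T)  = μ-cong s (λ _ → x≋ _) (λ _ → y≋ _) (S , T)
  μ-cong s x≋ y≋ (outside ∷ S , inside ∷ T)  = +-cong
    (*-congˡ (μ-cong s (λ _ → x≋ _) (λ _ → y≋ _) (S , T)))
    (μ-cong s (λ _ → *-congˡ (x≋ _)) (λ _ → y≋ _) (S , T))
  μ-cong s x≋ y≋ (inside ∷ S , inside ∷ T)   = μ-cong s (λ _ → *-congˡ (x≋ _)) (λ _ → y≋ _) (S , T)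

  bar-comb : ∀ {k} a b (x y : Λ k) → bar (λ S → a * x S + b * y S) ≋ (λ S → a * bar x S + b * bar y S)
  bar-comb a b x y S = solve 5 (λ s a b x y → s :* (a :* x :+ b :* y) := a :* (s :* x) :+ b :* (s :* y)) refl (sgn S) a b (x S) (y S)

  μ-linearˡ : ∀ {k} s (y : Λ k) → IsLinear (λ x → μ s x y)
  μ-linearˡ s y = record { cong = λ x≋ → μ-cong s x≋ (λ _ → refl) ; comb = λ a b x x′ → comb a b x x′ y }
    where
    comb : ∀ {k} a b (x x′ y : Λ k) → μ s (λ S → a * x S + b * x′ S) y ≋ (λ p → a * μ s x y p + b * μ s x′ y p)
    comb a b x x′ y ([] , []) = solve 5 (λ a b x x′ y → (a :* x :+ b :* x′) :* y := a :* (x :* y) :+ b :* (x′ :* y)) refl a b (x []) (x′ []) (y [])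
    comb a b x x′ y (outside ∷ S , outside ∷ T) = comb a b _ _ _ (S , T)
    comb a b x x′ y (inside ∷ S , outside ∷ T)  = comb a b _ _ _ (S , T)
    comb a b x x′ y (outside ∷ S , inside ∷ T)  = trans
      (+-cong (*-congˡ (comb a b _ _ _ (S , T)))
        (trans (μ-cong s (bar-comb a b _ _) (λ _ → refl) (S , T)) (comb a b _ _ _ (S , T))))
      (solve 7 (λ s a b p q p′ q′ → s :* (a :* p :+ b :* q) :+ (a :* p′ :+ b :* q′) := a :* (s :* p :+ p′) :+ b :* (s :* q :+ q′)) refl s a b _ _ _ _)
    comb a b x x′ y (inside ∷ S , inside ∷ T)   =
      trans (μ-cong s (bar-comb a b _ _) (λ _ → refl) (S , T)) (comb a b _ _ _ (S , T))

  μ-linearʳ : ∀ {k} s (x : Λ k) → IsLinear (μ s x)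
  μ-linearʳ s x = record { cong = λ y≋ → μ-cong s (λ _ → refl) y≋ ; comb = λ a b y y′ → comb a b x y y′ }
    where
    comb : ∀ {k} a b (x y y′ : Λ k) → μ s x (λ S → a * y S + b * y′ S) ≋ (λ p → a * μ s x y p + b * μ s x y′ p)
    comb a b x y y′ ([] , []) = solve 5 (λ a b x y y′ → x :* (a :* y :+ b :* y′) := a :* (x :* y) :+ b :* (x :* y′)) refl a b (x []) (y []) (y′ [])
    comb a b x y y′ (outside ∷ S , outside ∷ T) = comb a b _ _ _ (S , T)
    comb a b x y y′ (inside ∷ S , outside ∷ T)  = comb a b _ _ _ (S , T)
    comb a b x y y′ (outside ∷ S , inside ∷ T)  = trans
      (+-cong (*-congˡ (comb a b _ _ _ (S , T))) (comb a b _ _ _ (S , T)))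
      (solve 7 (λ s a b p q p′ q′ → s :* (a :* p :+ b :* q) :+ (a :* p′ :+ b :* q′) := a :* (s :* p :+ p′) :+ b :* (s :* q :+ q′)) refl s a b _ _ _ _)
    comb a b x y y′ (inside ∷ S , inside ∷ T)   = comb a b _ _ _ (S , T)

-- Products of vectors and their leading coefficients.

module Products {c ℓ} (F : Field c ℓ) where
  open Field F hiding (zero)
  open Exterior F
  open IntegerSolver commutativeRing using (solve; _:=_; _:+_; _:*_; _:-_; :-_; con)
  open Algebra.Properties.Ring ring using (-0#≈0#; -‿involutive)
  open Relation.Binary.Reasoning.Setoid setoid

  -- Associativity: with coordinates `v` in the vectors eᵢ + s fᵢ, a vector has the two halves `v`
  -- and `s * v`, and joins the first factor. At `s = 0#` it is a top, at `s = 1#` a diag.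
  G-μ-left : ∀ {k} s (v : V k) x y → G v (λ i → s * v i) (μ s x y) ≋ μ s (W v x) y
  G-μ-left s v x y ([] , []) = sym (zeroˡ _)
  G-μ-left s v x y (outside ∷ S , outside ∷ T) = G-μ-left s (v ∘ suc) _ _ (S , T)
  G-μ-left s v x y (inside ∷ S , outside ∷ T)  = trans
    (+-congˡ (-‿cong (G-μ-left s (v ∘ suc) _ _ (S , T))))
    (sym (IsLinear.axpy (μ-linearˡ s (y ∘ (outside ∷_))) (v zero) _ _ (S , T)))
  G-μ-left s v x y (outside ∷ S , inside ∷ T)  = begin
    s * v zero * m - G (v ∘ suc) (λ i → s * v (suc i)) (λ p → s * μ s xᵢ yₒ p + μ s (bar xₒ) yᵢ p) (S , T)
      ≈⟨ +-congˡ (-‿cong (trans (IsLinear.+-homo Gₗ _ _ (S , T))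
           (+-cong (trans (IsLinear.*-homo Gₗ s _ (S , T)) (*-congˡ (G-μ-left s (v ∘ suc) _ _ (S , T))))
             (trans (G-μ-left s (v ∘ suc) _ _ (S , T))
               (trans (μ-cong s (W-bar (v ∘ suc) xₒ) (λ _ → refl) (S , T))
                 (IsLinear.neg-homo (μ-linearˡ s yᵢ) _ (S , T))))))) ⟩
    s * v zero * m - (s * μ s (W (v ∘ suc) xᵢ) yₒ (S , T) + - b)
      ≈⟨ solve 5 (λ s v m a b → s :* v :* m :- (s :* a :- b) := s :* (v :* m :- a) :+ b) refl s (v zero) m _ b ⟩
    s * (v zero * m - μ s (W (v ∘ suc) xᵢ) yₒ (S , T)) + b
      ≈⟨ +-congʳ (*-congˡ (IsLinear.axpy (μ-linearˡ s yₒ) (v zero) _ _ (S , T))) ⟨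
    s * μ s (λ S → v zero * xₒ S - W (v ∘ suc) xᵢ S) yₒ (S , T) + b ∎
    where
    xᵢ = x ∘ (inside ∷_)
    xₒ = x ∘ (outside ∷_)
    yᵢ = y ∘ (inside ∷_)
    yₒ = y ∘ (outside ∷_)
    m = μ s xₒ yₒ (S , T)
    b = μ s (bar (W (v ∘ suc) xₒ)) yᵢ (S , T)
    Gₗ = G-linear (v ∘ suc) (λ i → s * v (suc i))
  G-μ-left s v x y (inside ∷ S , inside ∷ T)   = begin
    v zero * (s * a + b) - s * v zero * a + G (v ∘ suc) (λ i → s * v (suc i)) (μ s (bar xᵢ) yᵢ) (S , T)
      ≈⟨ +-congˡ (trans (G-μ-left s (v ∘ suc) _ _ (S , T))
           (trans (μ-cong s (W-bar (v ∘ suc) xᵢ) (λ _ → refl) (S , T))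
             (IsLinear.neg-homo (μ-linearˡ s yᵢ) _ (S , T)))) ⟩
    v zero * (s * a + b) - s * v zero * a - d
      -- The terms in `a` cancel because e₀ + s f₀ has square zero.
      ≈⟨ solve 5 (λ v s a b d → v :* (s :* a :+ b) :- s :* v :* a :- d := v :* b :- d) refl (v zero) s a b d ⟩
    v zero * b - d
      ≈⟨ IsLinear.axpy (μ-linearˡ s yᵢ) (v zero) _ _ (S , T) ⟨
    μ s (λ S → v zero * bar xₒ S - bar (W (v ∘ suc) xᵢ) S) yᵢ (S , T)
      ≈⟨ μ-cong s (λ S → solve 4 (λ v s x w → v :* (s :* x) :- s :* w := s :* (v :* x :- w)) refl (v zero) (sgn S) (xₒ S) _) (λ _ → refl) (S , T) ⟩
    μ s (bar (λ S → v zero * xₒ S - W (v ∘ suc) xᵢ S)) yᵢ (S , T) ∎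
    where
    xᵢ = x ∘ (inside ∷_)
    xₒ = x ∘ (outside ∷_)
    yᵢ = y ∘ (inside ∷_)
    a = μ s xᵢ (y ∘ (outside ∷_)) (S , T)
    b = μ s (bar xₒ) yᵢ (S , T)
    d = μ s (bar (W (v ∘ suc) xᵢ)) yᵢ (S , T)

  sgn-sgn : ∀ {k} (S : Subset k) → sgn S * sgn S ≈ 1#
  sgn-sgn []            = *-identityˡ 1#
  sgn-sgn (outside ∷ S) = sgn-sgn S
  sgn-sgn (inside ∷ S)  = trans (solve 1 (λ s → :- s :* :- s := s :* s) refl (sgn S)) (sgn-sgn S)

  bar-bar : ∀ {k} (x : Λ k) → bar (bar x) ≋ x
  bar-bar x S = trans (sym (*-assoc _ _ _)) (trans (*-congʳ (sgn-sgn S)) (*-identityˡ _))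

  bar-inside : ∀ {k} (x : Λ (suc k)) → bar x ∘ (inside ∷_) ≋ (λ S → - bar (x ∘ (inside ∷_)) S)
  bar-inside x S = solve 2 (λ s x → :- s :* x := :- (s :* x)) refl (sgn S) (x (inside ∷ S))

  μ-bar-inside : ∀ {k} s (x : Λ (suc k)) y →
    μ s (bar x ∘ (inside ∷_)) y ≋ (λ p → - μ s (bar (x ∘ (inside ∷_))) y p)
  μ-bar-inside s x y p = trans (μ-cong s (bar-inside x) (λ _ → refl) p) (IsLinear.neg-homo (μ-linearˡ s y) _ p)

  -- To reach the second factor, `v` has to pass the first, which costs its grade involution.
  G-μ-right : ∀ {k} s (v : V k) x y → G 𝟘 v (μ s x y) ≋ μ s (bar x) (W v y)
  G-μ-right s v x y ([] , []) = sym (zeroʳ _)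
  G-μ-right s v x y (outside ∷ S , outside ∷ T) = G-μ-right s (v ∘ suc) _ _ (S , T)
  G-μ-right s v x y (inside ∷ S , outside ∷ T)  = begin
    0# * m - G 𝟘 (v ∘ suc) (μ s xᵢ yₒ) (S , T)
      ≈⟨ +-congˡ (-‿cong (G-μ-right s (v ∘ suc) _ _ (S , T))) ⟩
    0# * m - μ s (bar xᵢ) (W (v ∘ suc) yₒ) (S , T)
      ≈⟨ solve 2 (λ m w → con (+ 0) :* m :- w := :- w) refl m _ ⟩
    - μ s (bar xᵢ) (W (v ∘ suc) yₒ) (S , T)
      ≈⟨ μ-bar-inside s x (W (v ∘ suc) yₒ) (S , T) ⟨
    μ s (bar x ∘ (inside ∷_)) (W (v ∘ suc) yₒ) (S , T) ∎
    where
    xᵢ = x ∘ (inside ∷_)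
    yₒ = y ∘ (outside ∷_)
    m = μ s (x ∘ (outside ∷_)) yₒ (S , T)
  G-μ-right s v x y (outside ∷ S , inside ∷ T)  = begin
    v zero * m - G 𝟘 (v ∘ suc) (λ p → s * μ s xᵢ yₒ p + μ s (bar xₒ) yᵢ p) (S , T)
      ≈⟨ +-congˡ (-‿cong (trans (IsLinear.+-homo Gₗ _ _ (S , T))
           (+-cong (trans (IsLinear.*-homo Gₗ s _ (S , T)) (*-congˡ (G-μ-right s (v ∘ suc) _ _ (S , T))))
             (G-μ-right s (v ∘ suc) _ _ (S , T))))) ⟩
    v zero * m - (s * a + μ s (bar (bar xₒ)) (W (v ∘ suc) yᵢ) (S , T))
      ≈⟨ +-congʳ (*-congˡ (μ-cong s (bar-bar xₒ) (λ _ → refl) (S , T))) ⟨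
    v zero * μ s (bar (bar xₒ)) yₒ (S , T) - (s * a + μ s (bar (bar xₒ)) (W (v ∘ suc) yᵢ) (S , T))
      ≈⟨ solve 4 (λ p s a q → p :- (s :* a :+ q) := s :* :- a :+ (p :- q)) refl _ s a _ ⟩
    s * - a + (v zero * μ s (bar (bar xₒ)) yₒ (S , T) - μ s (bar (bar xₒ)) (W (v ∘ suc) yᵢ) (S , T))
      ≈⟨ +-cong (*-congˡ (μ-bar-inside s x (W (v ∘ suc) yₒ) (S , T))) (IsLinear.axpy (μ-linearʳ s (bar (bar xₒ))) (v zero) _ _ (S , T)) ⟨
    s * μ s (bar x ∘ (inside ∷_)) (W (v ∘ suc) yₒ) (S , T) + μ s (bar (bar xₒ)) (λ T → v zero * yₒ T - W (v ∘ suc) yᵢ T) (S , T) ∎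
    where
    xᵢ = x ∘ (inside ∷_)
    xₒ = x ∘ (outside ∷_)
    yᵢ = y ∘ (inside ∷_)
    yₒ = y ∘ (outside ∷_)
    m = μ s xₒ yₒ (S , T)
    a = μ s (bar xᵢ) (W (v ∘ suc) yₒ) (S , T)
    Gₗ = G-linear 𝟘 (v ∘ suc)
  G-μ-right s v x y (inside ∷ S , inside ∷ T)   = begin
    0# * _ - v zero * a + G 𝟘 (v ∘ suc) (μ s (bar xᵢ) yᵢ) (S , T)
      ≈⟨ +-congˡ (G-μ-right s (v ∘ suc) _ _ (S , T)) ⟩
    0# * _ - v zero * a + d
      ≈⟨ solve 4 (λ m v a d → con (+ 0) :* m :- v :* a :+ d := :- (v :* a :- d)) refl _ (v zero) a d ⟩
    - (v zero * a - d)
      ≈⟨ -‿cong (+-congʳ (*-congˡ (μ-cong s (bar-bar xᵢ) (λ _ → refl) (S , T)))) ⟨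
    - (v zero * μ s (bar (bar xᵢ)) yₒ (S , T) - d)
      ≈⟨ -‿cong (IsLinear.axpy (μ-linearʳ s (bar (bar xᵢ))) (v zero) _ _ (S , T)) ⟨
    - μ s (bar (bar xᵢ)) (λ T → v zero * yₒ T - W (v ∘ suc) yᵢ T) (S , T)
      ≈⟨ IsLinear.neg-homo (μ-linearˡ s _) _ (S , T) ⟨
    μ s (λ S → - bar (bar xᵢ) S) (λ T → v zero * yₒ T - W (v ∘ suc) yᵢ T) (S , T)
      ≈⟨ μ-cong s (λ S → solve 2 (λ s x → :- (s :* (s :* x)) := s :* (:- s :* x)) refl (sgn S) (xᵢ S)) (λ _ → refl) (S , T) ⟩
    μ s (bar (bar x ∘ (inside ∷_))) (λ T → v zero * yₒ T - W (v ∘ suc) yᵢ T) (S , T) ∎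
    where
    xᵢ = x ∘ (inside ∷_)
    yᵢ = y ∘ (inside ∷_)
    yₒ = y ∘ (outside ∷_)
    a = μ s xᵢ yₒ (S , T)
    d = μ s (bar (bar xᵢ)) (W (v ∘ suc) yᵢ) (S , T)

  -- The signs caused by reordering are never evaluated. Only their being nonzero matters, and
  -- squaring to one ensures that.
  IsSign : Carrier → Set ℓ
  IsSign ε = ε * ε ≈ 1#

  IsSign-* : ∀ {ε δ} → IsSign ε → IsSign δ → IsSign (ε * δ)
  IsSign-* {ε} {δ} p q = trans (solve 2 (λ e d → e :* d :* (e :* d) := e :* e :* (d :* d)) refl ε δ) (trans (*-cong p q) (*-identityˡ _))

  -- The clause of `μ` for two `inside`s is free of `s`, since (e₀ + s f₀) f₀ = e₀ f₀. Hence one `ε`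
  -- serves the tops (`s = 0#`) and the diags (`s = 1#`) alike.
  μ-⊤ : ∀ k → Σ Carrier λ ε → IsSign ε × (∀ s (x y : Λ k) → μ s x y (⊤ , ⊤) ≈ ε * (x ⊤ * y ⊤))
  μ-⊤ zero    = 1# , *-identityˡ 1# , λ s x y → sym (*-identityˡ _)
  μ-⊤ (suc k) with μ-⊤ k
  ... | ε , sign , eq = ε * sgn (⊤ {k}) , IsSign-* sign (sgn-sgn (⊤ {k})) , λ s x y →
    trans (eq s (bar (x ∘ (inside ∷_))) (y ∘ (inside ∷_)))
      (solve 4 (λ e s x y → e :* (s :* x :* y) := e :* s :* (x :* y)) refl ε (sgn (⊤ {k})) (x ⊤) (y ⊤))

  𝟙 : ∀ {k} → Λ k
  𝟙 []            = 1#
  𝟙 (outside ∷ S) = 𝟙 S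
  𝟙 (inside ∷ S)  = 0#

  𝟙² : ∀ {k} → Λ² k
  𝟙² (S , T) = 𝟙 S * 𝟙 T

  μ-𝟙 : ∀ {k} s → μ s (𝟙 {k}) 𝟙 ≋ 𝟙²
  μ-𝟙 s ([] , [])                   = refl
  μ-𝟙 s (outside ∷ S , outside ∷ T) = μ-𝟙 s (S , T)
  μ-𝟙 s (inside ∷ S , outside ∷ T)  = trans (IsLinear.zero-homo (μ-linearˡ s 𝟙) (λ _ → refl) (S , T)) (sym (zeroˡ _))
  μ-𝟙 s (outside ∷ S , inside ∷ T)  = trans
    (+-cong (trans (*-congˡ (IsLinear.zero-homo (μ-linearˡ s 𝟙) (λ _ → refl) (S , T))) (zeroʳ s))
      (IsLinear.zero-homo (μ-linearʳ s (bar 𝟙)) (λ _ → refl) (S , T)))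
    (trans (+-identityˡ 0#) (sym (zeroʳ _)))
  μ-𝟙 s (inside ∷ S , inside ∷ T)   =
    trans (IsLinear.zero-homo (μ-linearʳ s (bar (λ _ → 0#))) (λ _ → refl) (S , T)) (sym (zeroʳ _))

  wedge : ∀ {k n} → (Fin n → V k) → Subset n → Λ k
  wedge vs []            = 𝟙
  wedge vs (outside ∷ S) = wedge (vs ∘ suc) S
  wedge vs (inside ∷ S)  = W (vs zero) (wedge (vs ∘ suc) S)

  -- A product of vectors is homogeneous, so the grade involution acts on it by a sign.
  bar-wedge : ∀ {k n} (vs : Fin n → V k) S → Σ Carrier λ ε → IsSign ε × bar (wedge vs S) ≋ (λ R → ε * wedge vs S R)
  bar-wedge {k} vs [] = 1# , *-identityˡ 1# , bar-𝟙
    where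
    bar-𝟙 : ∀ {k} → bar (𝟙 {k}) ≋ (λ R → 1# * 𝟙 R)
    bar-𝟙 []            = refl
    bar-𝟙 (outside ∷ R) = bar-𝟙 R
    bar-𝟙 (inside ∷ R)  = trans (zeroʳ _) (sym (zeroʳ _))
  bar-wedge vs (outside ∷ S) = bar-wedge (vs ∘ suc) S
  bar-wedge vs (inside ∷ S) with bar-wedge (vs ∘ suc) S
  ... | ε , sign , eq = - ε , trans (solve 1 (λ e → :- e :* :- e := e :* e) refl ε) sign , λ R → begin
    bar (W v x) R                       ≈⟨ -‿involutive _ ⟨
    - - bar (W v x) R                   ≈⟨ -‿cong (W-bar v x R) ⟨
    - W v (bar x) R                     ≈⟨ -‿cong (W-cong v eq R) ⟩
    - W v (λ R → ε * x R) R             ≈⟨ -‿cong (IsLinear.*-homo (W-linear v) ε x R) ⟩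
    - (ε * W v x R)                     ≈⟨ solve 2 (λ e w → :- (e :* w) := :- e :* w) refl ε _ ⟩
    - ε * W v x R                       ∎
    where
    v = vs zero
    x = wedge (vs ∘ suc) S

  -- Each vector raises the degree by exactly one. This is why a bracket of a set of the wrong size
  -- is zero.
  wedge-degree : ∀ {k n} (vs : Fin n → V k) S R → ¬ (∣ S ∣ ≡ ∣ R ∣) → wedge vs S R ≈ 0#
  wedge-degree vs []            R ≢ = 𝟙-degree R ≢
    where
    𝟙-degree : ∀ {k} (R : Subset k) → ¬ (0 ≡ ∣ R ∣) → 𝟙 R ≈ 0#
    𝟙-degree []            ≢ = contradiction ≡.refl ≢
    𝟙-degree (outside ∷ R) ≢ = 𝟙-degree R ≢
    𝟙-degree (inside ∷ R)  ≢ = refl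
  wedge-degree vs (outside ∷ S) R ≢ = wedge-degree (vs ∘ suc) S R ≢
  wedge-degree vs (inside ∷ S)  R ≢ =
    W-degree (vs zero) ∣ S ∣ (wedge (vs ∘ suc) S) (wedge-degree (vs ∘ suc) S) R ≢
    where
    W-degree : ∀ {k} (v : V k) d x → (∀ R → ¬ (d ≡ ∣ R ∣) → x R ≈ 0#) → ∀ R → ¬ (suc d ≡ ∣ R ∣) → W v x R ≈ 0#
    W-degree v d x h []            ≢ = refl
    W-degree v d x h (outside ∷ R) ≢ = W-degree (v ∘ suc) d _ (λ R → h (outside ∷ R)) R ≢
    -- An `x` of degree 0 has no part containing the first basis vector, so there is no lower degree
    -- to recurse on.
    W-degree v zero x h (inside ∷ R) ≢ = trans
      (+-cong (trans (*-congˡ (h (outside ∷ R) (λ eq → ≢ (≡.cong suc eq)))) (zeroʳ _))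
        (-‿cong (IsLinear.zero-homo (W-linear (v ∘ suc)) (λ R → h (inside ∷ R) (λ ())) R)))
      (trans (+-identityˡ _) -0#≈0#)
    W-degree v (suc d) x h (inside ∷ R) ≢ = trans
      (+-cong (trans (*-congˡ (h (outside ∷ R) (λ eq → ≢ (≡.cong suc eq)))) (zeroʳ _))
        (-‿cong (W-degree (v ∘ suc) d _ (λ R ≢′ → h (inside ∷ R) (λ eq → ≢′ (ℕₚ.suc-injective eq))) R (λ eq → ≢ (≡.cong suc eq)))))
      (trans (+-identityˡ _) -0#≈0#)

  -- Determinants as leading coefficients.

  module _ where
    open Det F
    open Algebra.Properties.Semiring.Sum semiring using (sum; sum-cong-≋)

    W-sum : ∀ {k N} (v : V k) (x : Fin N → Λ k) →
      W v (λ R → sum (λ j → x j R)) ≋ (λ R → sum (λ j → W v (x j) R))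
    W-sum {N = zero}  v x R = IsLinear.zero-homo (W-linear v) (λ _ → refl) R
    W-sum {N = suc N} v x R = trans (IsLinear.+-homo (W-linear v) _ _ R) (+-congˡ (W-sum v (x ∘ suc) R))

    alt-cong : ∀ m {x y} → x ≈ y → alt m x ≈ alt m y
    alt-cong zero    x≈y = x≈y
    alt-cong (suc m) x≈y = -‿cong (alt-cong m x≈y)

    W-alt : ∀ {k} (v : V k) m a (x : Λ k) → W v (λ R → alt m (a * x R)) ≋ (λ R → alt m (a * W v x R))
    W-alt v zero    a x R = IsLinear.*-homo (W-linear v) a x R
    W-alt v (suc m) a x R = trans (IsLinear.neg-homo (W-linear v) _ R) (-‿cong (W-alt v m a x R))

    neg-sum : ∀ {N} (f : Fin N → Carrier) → - sum f ≈ sum (λ j → - f j)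
    neg-sum {zero}  f = -0#≈0#
    neg-sum {suc N} f = trans (solve 2 (λ x y → :- (x :+ y) := :- x :+ :- y) refl (f zero) _) (+-congˡ (neg-sum (f ∘ suc)))

    wedge-outside : ∀ {k n} (vs : Fin n → V (suc k)) S R → wedge vs S (outside ∷ R) ≈ wedge (λ j → vs j ∘ suc) S R
    wedge-outside vs []            R = refl
    wedge-outside vs (outside ∷ S) R = wedge-outside (vs ∘ suc) S R
    wedge-outside vs (inside ∷ S)  R = W-cong (vs zero ∘ suc) (wedge-outside (vs ∘ suc) S) R

    -- The first basis vector comes from exactly one factor `j`. Moving it to the front past the
    -- earlier factors gives the sign, and the other factors contribute only their tails: this is
    -- the cofactor expansion defining `det`.
    wedge-inside : ∀ {k N} (vs : Fin (suc N) → V (suc k)) R →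
      wedge vs ⊤ (inside ∷ R) ≈ sum (λ j → alt (toℕ' j) (vs j zero * wedge (λ b → vs (punchIn j b) ∘ suc) ⊤ R))
    wedge-inside {N = zero} vs R = +-congˡ (trans (-‿cong (IsLinear.zero-homo (W-linear (vs zero ∘ suc)) (λ _ → refl) R)) -0#≈0#)
    wedge-inside {N = suc N} vs R = +-cong (*-congˡ (wedge-outside (vs ∘ suc) ⊤ R)) (begin
      - W v (λ R → wedge (vs ∘ suc) ⊤ (inside ∷ R)) R
        ≈⟨ -‿cong (trans (W-cong v (wedge-inside (vs ∘ suc)) R) (W-sum v (λ j R → alt (toℕ' j) (vs (suc j) zero * minor j R)) R)) ⟩
      - sum (λ j → W v (λ R → alt (toℕ' j) (vs (suc j) zero * minor j R)) R)
        ≈⟨ neg-sum (λ j → W v (λ R → alt (toℕ' j) (vs (suc j) zero * minor j R)) R) ⟩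
      sum (λ j → - W v (λ R → alt (toℕ' j) (vs (suc j) zero * minor j R)) R)
        ≈⟨ sum-cong-≋ (λ j → -‿cong (W-alt v (toℕ' j) (vs (suc j) zero) (minor j) R)) ⟩
      sum (λ j → - alt (toℕ' j) (vs (suc j) zero * W v (minor j) R)) ∎)
      where
      v = vs zero ∘ suc
      minor : Fin (suc N) → Λ _
      minor j = wedge (λ b → vs (suc (punchIn j b)) ∘ suc) ⊤

    det≈wedge : ∀ {k} (M : Fin k → Fin k → Carrier) → det M ≈ wedge (λ j i → M i j) ⊤ ⊤
    det≈wedge {zero}  M = refl
    det≈wedge {suc k} M = trans
      (sum-cong-≋ (λ j → alt-cong (toℕ' j) (*-congˡ {M zero j} (det≈wedge (λ a b → M (suc a) (punchIn j b))))))
      (sym (wedge-inside (λ j i → M i j) ⊤))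

  -- `IsBasis` selects columns by `lookup` in a list, at a `cast` index. This lemma and the next two
  -- turn that selection into the recursion of `wedge` on the subset.
  wedge-cast : ∀ {k m n} .(eq : m ≡ n) (vs : Fin n → V k) → wedge (vs ∘ cast eq) ⊤ ≡ wedge vs ⊤
  wedge-cast {m = zero}  {zero}  eq vs = ≡.refl
  wedge-cast {m = suc m} {suc n} eq vs = ≡.cong (W (vs zero)) (wedge-cast (ℕₚ.suc-injective eq) (vs ∘ suc))

  wedge-lookup : ∀ {k n} (vs : Fin n → V k) (js : List (Fin n)) →
    wedge (vs ∘ lookup js) ⊤ ≡ foldr (W ∘ vs) 𝟙 js
  wedge-lookup vs []       = ≡.refl
  wedge-lookup vs (j ∷ js) = ≡.cong (W (vs j)) (wedge-lookup vs js)

  foldr-elems : ∀ {k n} (vs : Fin n → V k) S → foldr (W ∘ vs) 𝟙 (elems S) ≡ wedge vs S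
  foldr-elems vs []            = ≡.refl
  foldr-elems vs (outside ∷ S) = ≡.trans (foldr-map _ suc 𝟙 (elems S)) (foldr-elems (vs ∘ suc) S)
  foldr-elems vs (inside ∷ S)  = ≡.cong (W (vs zero)) (≡.trans (foldr-map _ suc 𝟙 (elems S)) (foldr-elems (vs ∘ suc) S))

  length-elems : ∀ {n} (S : Subset n) → length (elems S) ≡ ∣ S ∣
  length-elems []            = ≡.refl
  length-elems (outside ∷ S) = ≡.trans (length-map suc (elems S)) (length-elems S)
  length-elems (inside ∷ S)  = ≡.cong suc (≡.trans (length-map suc (elems S)) (length-elems S))

-- Brackets of sets of columns, and bases.

module Bracket {c ℓ} (F : Field c ℓ) {r n : ℕ} (M : Fin r → Fin n → Field.Carrier F) where
  open Field F hiding (zero)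
  open Exterior F
  open Products F
  open Represented F M
  open Det F

  column : Fin n → V r
  column e i = M i e

  [_] : Subset n → Carrier
  [ S ] = wedge column S ⊤

  det≈[] : ∀ S (eq : length (elems S) ≡ r) → det (λ i j → M i (lookup (elems S) (cast (≡.sym eq) j))) ≈ [ S ]
  det≈[] S eq = trans (det≈wedge (λ i j → M i (lookup (elems S) (cast (≡.sym eq) j)))) (reflexive (≡.cong (λ x → x ⊤)
    (≡.trans (wedge-cast (≡.sym eq) (column ∘ lookup (elems S)))
      (≡.trans (wedge-lookup column (elems S)) (foldr-elems column S)))))

  []-degree : ∀ S → ¬ (∣ S ∣ ≡ r) → [ S ] ≈ 0#
  []-degree S ≢ = wedge-degree column S ⊤ (λ eq → ≢ (≡.trans eq (∣⊤∣≡n r)))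

  basis⇒[]≉0 : ∀ {S} → IsBasis S → ¬ ([ S ] ≈ 0#)
  basis⇒[]≉0 {S} (eq , ≉0) ≈0 = ≉0 (trans (det≈[] S eq) ≈0)

  -- A set of the wrong size has bracket zero, so a nonzero bracket also supplies the size that
  -- `IsBasis` demands.
  []≉0⇒basis : ∀ {S} → ¬ ([ S ] ≈ 0#) → IsBasis S
  []≉0⇒basis {S} ≉0 with ∣ S ∣ ℕ.≟ r
  ... | yes eq = length≡r , λ ≈0 → ≉0 (trans (sym (det≈[] S length≡r)) ≈0)
    where
    length≡r : length (elems S) ≡ r
    length≡r = ≡.trans (length-elems S) eq
  ... | no  ≢  = contradiction ([]-degree S ≢) ≉0

  basis⇒∣∣≡r : ∀ {S} → IsBasis S → ∣ S ∣ ≡ r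
  basis⇒∣∣≡r {S} (eq , _) = ≡.trans (≡.sym (length-elems S)) eq

-- Sums over supersets, weighted by polynomials in the cardinality.

module SubsetSums {c ℓ} (F : Field c ℓ) where
  open Field F hiding (zero)
  open Exterior F
  open IntegerSolver commutativeRing using (solve; _:=_; _:+_; _:*_; _:-_; :-_; con)
  open Algebra.Properties.Semiring.Mult semiring using () renaming (_×_ to _·_; ×-homo-+ to ·-homo-+)
  open Algebra.Properties.Ring ring using (x∙y⁻¹≈ε⇒x≈y)
  open Algebra.Properties.AbelianGroup +-abelianGroup using (xyx⁻¹≈y)
  open Relation.Binary.Reasoning.Setoid setoid

  -- The sum of f over the supersets of W.
  up : ∀ {n} → (Subset n → Carrier) → Subset n → Carrier
  up f []            = f []
  up f (inside ∷ W)  = up (f ∘ (inside ∷_)) W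
  up f (outside ∷ W) = up (f ∘ (inside ∷_)) W + up (f ∘ (outside ∷_)) W

  up-cong : ∀ {n} {f g : Subset n → Carrier} → f ≋ g → up f ≋ up g
  up-cong f≋g []            = f≋g []
  up-cong f≋g (inside ∷ W)  = up-cong (f≋g ∘ (inside ∷_)) W
  up-cong f≋g (outside ∷ W) = +-cong (up-cong (f≋g ∘ (inside ∷_)) W) (up-cong (f≋g ∘ (outside ∷_)) W)

  up-linear : ∀ {n} → IsLinear (up {n})
  up-linear = record { cong = up-cong ; comb = comb }
    where
    comb : ∀ {n} a b (f g : Subset n → Carrier) → up (λ U → a * f U + b * g U) ≋ (λ W → a * up f W + b * up g W)
    comb a b f g []            = refl
    comb a b f g (inside ∷ W)  = comb a b _ _ W
    comb a b f g (outside ∷ W) = trans (+-cong (comb a b _ _ W) (comb a b _ _ W))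
      (solve 6 (λ a b x y x′ y′ → a :* x :+ b :* y :+ (a :* x′ :+ b :* y′) := a :* (x :+ x′) :+ b :* (y :+ y′)) refl a b _ _ _ _)

  linear-up : ∀ {n} {I J : Set} {L : (I → Carrier) → J → Carrier} → IsLinear L →
    (f : Subset n → I → Carrier) → ∀ W → (λ j → up (λ U → L (f U) j) W) ≋ L (λ i → up (λ U → f U i) W)
  linear-up L-linear f []            j = refl
  linear-up L-linear f (inside ∷ W)  j = linear-up L-linear (f ∘ (inside ∷_)) W j
  linear-up L-linear f (outside ∷ W) j = trans
    (+-cong (linear-up L-linear (f ∘ (inside ∷_)) W j) (linear-up L-linear (f ∘ (outside ∷_)) W j))
    (sym (IsLinear.+-homo L-linear _ _ j))

  up-single : ∀ {n} (f : Subset n → Carrier) U₀ → (∀ U → ¬ (U ≡ U₀) → f U ≈ 0#) → up f ⊥ ≈ f U₀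
  up-single f []             h = refl
  up-single f (inside ∷ U₀)  h = trans
    (+-cong (up-single _ U₀ (λ U ≢ → h (inside ∷ U) (≢ ∘ ∷-injectiveʳ)))
      (IsLinear.zero-homo up-linear (λ U → h (outside ∷ U) (λ ())) ⊥))
    (+-identityʳ _)
  up-single f (outside ∷ U₀) h = trans
    (+-cong (IsLinear.zero-homo up-linear (λ U → h (inside ∷ U) (λ ())) ⊥)
      (up-single _ U₀ (λ U ≢ → h (outside ∷ U) (≢ ∘ ∷-injectiveʳ))))
    (+-identityˡ _)

  Vanishes : ∀ {n} → (Subset n → Carrier) → ℕ → Set ℓ
  Vanishes f d = ∀ W → ∣ W ∣ ≤ d → up f W ≈ 0#

  -- Here `∣ U ∣` is `∣ W ∣` plus the number of elements of `U` outside `W`. So the sum is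
  -- `∣ W ∣ · 1#` times `up f W`, plus `up f` at every set with one element more than `W`, and all
  -- of these vanish.
  up-card : ∀ {n} (f : Subset n → Carrier) W → Vanishes f (suc ∣ W ∣) → up (λ U → (∣ U ∣ · 1#) * f U) W ≈ 0#
  up-card f []            h = zeroˡ _
  up-card f (inside ∷ W)  h = begin
    up (λ U → (1# + ∣ U ∣ · 1#) * f (inside ∷ U)) W
      ≈⟨ up-cong (λ U → trans (distribʳ _ _ _) (+-congʳ (*-identityˡ _))) W ⟩
    up (λ U → f (inside ∷ U) + (∣ U ∣ · 1#) * f (inside ∷ U)) W
      ≈⟨ IsLinear.+-homo up-linear _ _ W ⟩
    up (f ∘ (inside ∷_)) W + up (λ U → (∣ U ∣ · 1#) * f (inside ∷ U)) W
      ≈⟨ +-cong (h (inside ∷ W) (ℕₚ.n≤1+n _)) (up-card _ W (λ W′ le → h (inside ∷ W′) (ℕ.s≤s le))) ⟩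
    0# + 0#
      ≈⟨ +-identityˡ 0# ⟩
    0# ∎
  up-card f (outside ∷ W) h = begin
    up (λ U → (1# + ∣ U ∣ · 1#) * f (inside ∷ U)) W + up (λ U → (∣ U ∣ · 1#) * f (outside ∷ U)) W
      ≈⟨ IsLinear.+-homo up-linear _ _ W ⟨
    up (λ U → (1# + ∣ U ∣ · 1#) * f (inside ∷ U) + (∣ U ∣ · 1#) * f (outside ∷ U)) W
      -- Regroup so that `∣ U ∣` multiplies the sum of both choices for the head; the induction
      -- applies to that sum as one function of the tail.
      ≈⟨ up-cong (λ U → trans (+-congʳ (trans (distribʳ _ _ _) (+-congʳ (*-identityˡ _))))
           (trans (+-assoc _ _ _) (+-congˡ (sym (distribˡ _ _ _))))) W ⟩
    up (λ U → f (inside ∷ U) + (∣ U ∣ · 1#) * (f (inside ∷ U) + f (outside ∷ U))) W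
      ≈⟨ IsLinear.+-homo up-linear _ _ W ⟩
    up (f ∘ (inside ∷_)) W + up (λ U → (∣ U ∣ · 1#) * (f (inside ∷ U) + f (outside ∷ U))) W
      ≈⟨ +-cong (h (inside ∷ W) ℕₚ.≤-refl)
           (up-card _ W (λ W′ le → trans (IsLinear.+-homo up-linear _ _ W′) (h (outside ∷ W′) le))) ⟩
    0# + 0#
      ≈⟨ +-identityˡ 0# ⟩
    0# ∎

  -- Each linear factor in `∣ U ∣` costs one level, because `up-card` looks one element beyond `W`.
  vanishes-card : ∀ {n} (f : Subset n → Carrier) d a → Vanishes f (suc d) → Vanishes (λ U → (∣ U ∣ · 1# - a) * f U) d
  vanishes-card f d a h W le = begin
    up (λ U → (∣ U ∣ · 1# - a) * f U) W
      ≈⟨ up-cong (λ U → solve 3 (λ u a f → (u :- a) :* f := :- (a :* f :- u :* f)) refl (∣ U ∣ · 1#) a (f U)) W ⟩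
    up (λ U → - (a * f U - (∣ U ∣ · 1#) * f U)) W
      ≈⟨ trans (IsLinear.neg-homo up-linear _ W) (-‿cong (IsLinear.axpy up-linear a _ _ W)) ⟩
    - (a * up f W - up (λ U → (∣ U ∣ · 1#) * f U) W)
      ≈⟨ -‿cong (+-cong (*-congˡ (h W (ℕₚ.m≤n⇒m≤1+n le)))
           (-‿cong (up-card f W (λ W′ le′ → h W′ (ℕₚ.≤-trans le′ (ℕ.s≤s le)))))) ⟩
    - (a * 0# - 0#)
      ≈⟨ solve 1 (λ a → :- (a :* con (+ 0) :- con (+ 0)) := con (+ 0)) refl a ⟩
    0# ∎

  -- The product (u - v) (u - v - 1) ⋯ (u - v - d + 1), whose zeros are the `d` consecutive integers
  -- from `v` on.
  weight : ℕ → ℕ → ℕ → Carrier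
  weight zero    v u = 1#
  weight (suc d) v u = weight d (suc v) u * (u · 1# - v · 1#)

  vanishes-weight : ∀ {n} (f : Subset n → Carrier) d v → Vanishes f d → Vanishes (λ U → weight d v ∣ U ∣ * f U) 0
  vanishes-weight f zero    v h W le = trans (up-cong (λ U → *-identityˡ _) W) (h W le)
  vanishes-weight f (suc d) v h W le = trans (up-cong (λ U → *-assoc _ _ _) W)
    (vanishes-weight _ d (suc v) (vanishes-card f d (v · 1#) h) W le)

  weight-zero : ∀ d v u → v ≤ u → u < v ℕ.+ d → weight d v u ≈ 0#
  weight-zero zero    v u v≤u u<v = contradiction (ℕₚ.<-≤-trans u<v (ℕₚ.≤-trans (ℕₚ.≤-reflexive (ℕₚ.+-identityʳ v)) v≤u)) (ℕₚ.<-irrefl ≡.refl)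
  weight-zero (suc d) v u v≤u u<v+d with v ℕ.≟ u
  ... | yes ≡.refl = trans (*-congˡ (-‿inverseʳ _)) (zeroʳ _)
  ... | no  v≢u    = trans (*-congʳ (weight-zero d (suc v) u (ℕₚ.≤∧≢⇒< v≤u v≢u)
                       (≡.subst (u <_) (ℕₚ.+-suc v d) u<v+d))) (zeroˡ _)

  x*y≈0⇒y≈0 : ∀ {x y} → ¬ (x ≈ 0#) → x * y ≈ 0# → y ≈ 0#
  x*y≈0⇒y≈0 {x} {y} x≉0 xy≈0 with inverse x x≉0
  ... | x⁻¹ , eq = begin
    y               ≈⟨ *-identityˡ y ⟨
    1# * y          ≈⟨ *-congʳ eq ⟨
    x * x⁻¹ * y     ≈⟨ solve 3 (λ x i y → x :* i :* y := i :* (x :* y)) refl x x⁻¹ y ⟩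
    x⁻¹ * (x * y)   ≈⟨ *-congˡ xy≈0 ⟩
    x⁻¹ * 0#        ≈⟨ zeroʳ x⁻¹ ⟩
    0#              ∎

  -- Below the zeros every factor is minus a positive multiple of `1#`; this is where characteristic
  -- zero enters.
  weight-nonzero : CharZero F → ∀ d v u → u < v → ¬ (weight d v u ≈ 0#)
  weight-nonzero char zero    v u u<v ≈0 = 0≉1 (sym ≈0)
  weight-nonzero char (suc d) v u u<v ≈0 = ℕₚ.<-irrefl (≡.trans (≡.sym (ℕₚ.+-identityʳ u))
      (≡.trans (≡.cong (u ℕ.+_) (≡.sym (char (v ℕ.∸ u) v-u≈0))) (ℕₚ.m+[n∸m]≡n (ℕₚ.<⇒≤ u<v)))) u<v
    where
    u≈v : u · 1# ≈ v · 1#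
    u≈v = x∙y⁻¹≈ε⇒x≈y _ _ (x*y≈0⇒y≈0 (weight-nonzero char d (suc v) u (ℕₚ.m<n⇒m<1+n u<v)) ≈0)
    v-u≈0 : (v ℕ.∸ u) · 1# ≈ 0#
    v-u≈0 = begin
      (v ℕ.∸ u) · 1#                           ≈⟨ xyx⁻¹≈y (u · 1#) _ ⟨
      u · 1# + (v ℕ.∸ u) · 1# - u · 1#         ≈⟨ +-congʳ (·-homo-+ 1# u (v ℕ.∸ u)) ⟨
      (u ℕ.+ (v ℕ.∸ u)) · 1# - u · 1#          ≡⟨ ≡.cong (λ k → k · 1# - u · 1#) (ℕₚ.m+[n∸m]≡n (ℕₚ.<⇒≤ u<v)) ⟩
      v · 1# - u · 1#                          ≈⟨ +-congʳ u≈v ⟨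
      u · 1# - u · 1#                          ≈⟨ -‿inverseʳ _ ⟩
      0#                                       ∎

-- Cardinalities of subsets, and double negation over finitely many subsets.

module SubsetProperties where
  -- Inclusion at a single element as a `Bool`, so that `monomial` can test inclusions element by
  -- element.
  imp : Bool → Bool → Bool
  imp s t = not s ∨ t

  ⊆⇒imp : ∀ {n s t} {p q : Subset n} → s ∷ p ⊆ t ∷ q → imp s t ≡ true
  ⊆⇒imp {s = outside} p⊆q = ≡.refl
  ⊆⇒imp {s = inside}  p⊆q with p⊆q here
  ... | here = ≡.refl

  imp⇒⊆ : ∀ {n s t} {p q : Subset n} → imp s t ≡ true → p ⊆ q → s ∷ p ⊆ t ∷ q
  imp⇒⊆ {s = outside}             eq p⊆q = out⊆ p⊆q
  imp⇒⊆ {s = inside} {t = inside} eq p⊆q = in⊆in p⊆q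

  ∣p∪q∣≤∣p∣+∣q∣ : ∀ {n} (p q : Subset n) → ∣ p ∪ q ∣ ≤ ∣ p ∣ ℕ.+ ∣ q ∣
  ∣p∪q∣≤∣p∣+∣q∣ []            []            = ℕ.z≤n
  ∣p∪q∣≤∣p∣+∣q∣ (inside ∷ p)  (inside ∷ q)  = ℕ.s≤s (ℕₚ.≤-trans (∣p∪q∣≤∣p∣+∣q∣ p q) (ℕₚ.+-monoʳ-≤ ∣ p ∣ (ℕₚ.n≤1+n _)))
  ∣p∪q∣≤∣p∣+∣q∣ (inside ∷ p)  (outside ∷ q) = ℕ.s≤s (∣p∪q∣≤∣p∣+∣q∣ p q)
  ∣p∪q∣≤∣p∣+∣q∣ (outside ∷ p) (inside ∷ q)  = ℕₚ.≤-trans (ℕ.s≤s (∣p∪q∣≤∣p∣+∣q∣ p q)) (ℕₚ.≤-reflexive (≡.sym (ℕₚ.+-suc ∣ p ∣ ∣ q ∣)))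
  ∣p∪q∣≤∣p∣+∣q∣ (outside ∷ p) (outside ∷ q) = ∣p∪q∣≤∣p∣+∣q∣ p q

  -- Elements of `t` outside `p` lie in `q` or `s`; if these are small, `p ∩ t` must be large.
  ∣∣-cover : ∀ {n} (t p q s : Subset n) → t ⊆ p ∪ (q ∪ s) → ∣ t ∣ ≤ ∣ p ∩ t ∣ ℕ.+ (∣ q ∣ ℕ.+ ∣ s ∣)
  ∣∣-cover t p q s t⊆ = ℕₚ.≤-trans (p⊆q⇒∣p∣≤∣q∣ {q = (p ∩ t) ∪ (q ∪ s)} t⊆′)
    (ℕₚ.≤-trans (∣p∪q∣≤∣p∣+∣q∣ (p ∩ t) (q ∪ s)) (ℕₚ.+-monoʳ-≤ ∣ p ∩ t ∣ (∣p∪q∣≤∣p∣+∣q∣ q s)))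
    where
    t⊆′ : t ⊆ (p ∩ t) ∪ (q ∪ s)
    t⊆′ x∈t with x∈p∪q⁻ p (q ∪ s) (t⊆ x∈t)
    ... | inj₁ x∈p  = x∈p∪q⁺ (inj₁ (x∈p∩q⁺ (x∈p , x∈t)))
    ... | inj₂ x∈qs = x∈p∪q⁺ (inj₂ x∈qs)

  ⊆∧∣∣≥⇒≡ : ∀ {n} {p q : Subset n} → p ⊆ q → ∣ q ∣ ≤ ∣ p ∣ → p ≡ q
  ⊆∧∣∣≥⇒≡ {p = []}          {[]}          p⊆q le = ≡.refl
  ⊆∧∣∣≥⇒≡ {p = inside ∷ p}  {inside ∷ q}  p⊆q (ℕ.s≤s le) = ≡.cong (inside ∷_) (⊆∧∣∣≥⇒≡ (drop-∷-⊆ p⊆q) le)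
  ⊆∧∣∣≥⇒≡ {p = outside ∷ p} {outside ∷ q} p⊆q le = ≡.cong (outside ∷_) (⊆∧∣∣≥⇒≡ (drop-∷-⊆ p⊆q) le)
  ⊆∧∣∣≥⇒≡ {p = outside ∷ p} {inside ∷ q}  p⊆q le =
    contradiction (ℕₚ.≤-trans le (p⊆q⇒∣p∣≤∣q∣ (drop-∷-⊆ p⊆q))) (ℕₚ.<-irrefl ≡.refl)
  ⊆∧∣∣≥⇒≡ {p = inside ∷ p}  {outside ∷ q} p⊆q le with p⊆q here
  ... | ()

  ∣p∣≡∣p─q∣+∣p∩q∣ : ∀ {n} (p q : Subset n) → ∣ p ∣ ≡ ∣ p ─ q ∣ ℕ.+ ∣ p ∩ q ∣
  ∣p∣≡∣p─q∣+∣p∩q∣ []            []            = ≡.refl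
  ∣p∣≡∣p─q∣+∣p∩q∣ (inside ∷ p)  (inside ∷ q)  = ≡.trans (≡.cong suc (∣p∣≡∣p─q∣+∣p∩q∣ p q)) (≡.sym (ℕₚ.+-suc _ _))
  ∣p∣≡∣p─q∣+∣p∩q∣ (inside ∷ p)  (outside ∷ q) = ≡.cong suc (∣p∣≡∣p─q∣+∣p∩q∣ p q)
  ∣p∣≡∣p─q∣+∣p∩q∣ (outside ∷ p) (inside ∷ q)  = ∣p∣≡∣p─q∣+∣p∩q∣ p q
  ∣p∣≡∣p─q∣+∣p∩q∣ (outside ∷ p) (outside ∷ q) = ∣p∣≡∣p─q∣+∣p∩q∣ p q

  -- The additive form avoids truncated subtraction. It shows that an exchange preserves the size of
  -- `p` exactly when `u` and `v` have equal size.
  ∣[p─u]∪v∣+∣u∣≡∣p∣+∣v∣ : ∀ {n} (p q u v : Subset n) → u ⊆ p → v ⊆ q ─ p → ∣ (p ─ u) ∪ v ∣ ℕ.+ ∣ u ∣ ≡ ∣ p ∣ ℕ.+ ∣ v ∣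
  ∣[p─u]∪v∣+∣u∣≡∣p∣+∣v∣ [] [] [] [] u⊆ v⊆ = ≡.refl
  ∣[p─u]∪v∣+∣u∣≡∣p∣+∣v∣ (inside ∷ p) (b ∷ q) (u ∷ us) (inside ∷ v) u⊆ v⊆ with v⊆ here
  ... | ()
  ∣[p─u]∪v∣+∣u∣≡∣p∣+∣v∣ (inside ∷ p) (b ∷ q) (inside ∷ u) (outside ∷ v) u⊆ v⊆ =
    ≡.trans (ℕₚ.+-suc _ _) (≡.cong suc (∣[p─u]∪v∣+∣u∣≡∣p∣+∣v∣ p q u v (drop-∷-⊆ u⊆) (drop-∷-⊆ v⊆)))
  ∣[p─u]∪v∣+∣u∣≡∣p∣+∣v∣ (inside ∷ p) (b ∷ q) (outside ∷ u) (outside ∷ v) u⊆ v⊆ =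
    ≡.cong suc (∣[p─u]∪v∣+∣u∣≡∣p∣+∣v∣ p q u v (drop-∷-⊆ u⊆) (drop-∷-⊆ v⊆))
  ∣[p─u]∪v∣+∣u∣≡∣p∣+∣v∣ (outside ∷ p) (b ∷ q) (inside ∷ u) (v ∷ vs) u⊆ v⊆ with u⊆ here
  ... | ()
  ∣[p─u]∪v∣+∣u∣≡∣p∣+∣v∣ (outside ∷ p) (b ∷ q) (outside ∷ u) (inside ∷ v) u⊆ v⊆ =
    ≡.trans (≡.cong suc (∣[p─u]∪v∣+∣u∣≡∣p∣+∣v∣ p q u v (drop-∷-⊆ u⊆) (drop-∷-⊆ v⊆))) (≡.sym (ℕₚ.+-suc _ _))
  ∣[p─u]∪v∣+∣u∣≡∣p∣+∣v∣ (outside ∷ p) (b ∷ q) (outside ∷ u) (outside ∷ v) u⊆ v⊆ =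
    ∣[p─u]∪v∣+∣u∣≡∣p∣+∣v∣ p q u v (drop-∷-⊆ u⊆) (drop-∷-⊆ v⊆)

  -- For the extreme pair `U = A ─ B`, `V = B ─ A`, at which the exchange swaps `A` and `B`.
  [p─[p─q]]∪[q─p]≡q : ∀ {n} (p q : Subset n) → (p ─ (p ─ q)) ∪ (q ─ p) ≡ q
  [p─[p─q]]∪[q─p]≡q []            []            = ≡.refl
  [p─[p─q]]∪[q─p]≡q (inside ∷ p)  (inside ∷ q)  = ≡.cong (inside ∷_) ([p─[p─q]]∪[q─p]≡q p q)
  [p─[p─q]]∪[q─p]≡q (inside ∷ p)  (outside ∷ q) = ≡.cong (outside ∷_) ([p─[p─q]]∪[q─p]≡q p q)
  [p─[p─q]]∪[q─p]≡q (outside ∷ p) (inside ∷ q)  = ≡.cong (inside ∷_) ([p─[p─q]]∪[q─p]≡q p q)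
  [p─[p─q]]∪[q─p]≡q (outside ∷ p) (outside ∷ q) = ≡.cong (outside ∷_) ([p─[p─q]]∪[q─p]≡q p q)

  -- Double negation commutes with finite conjunctions, and there are finitely many subsets.
  ¬¬-∀ : ∀ {ℓ n} {Q : Subset n → Set ℓ} → (∀ S → ¬ ¬ Q S) → ¬ ¬ (∀ S → Q S)
  ¬¬-∀ {n = zero}  h k = h [] (λ q → k (λ { [] → q }))
  ¬¬-∀ {n = suc n} h k =
    ¬¬-∀ (h ∘ (inside ∷_)) λ hᵢ →
    ¬¬-∀ (h ∘ (outside ∷_)) λ hₒ →
    k λ { (inside ∷ S) → hᵢ S ; (outside ∷ S) → hₒ S }

  ¬¬-→ : ∀ {a b} {A : Set a} {B : Set b} → (A → ¬ ¬ B) → ¬ ¬ (A → B)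
  ¬¬-→ f k = k (λ a → contradiction (λ b → k (λ _ → b)) (f a))

-- The sum of exchange products, expanded one element at a time.

module Exchange {c ℓ} (F : Field c ℓ) {k : ℕ} where
  open Field F hiding (zero)
  open Exterior F
  open Products F
  open SubsetSums F
  open SubsetProperties
  open IntegerSolver commutativeRing using (solve; _:=_; _:+_; _:*_; _:-_; :-_; con)

  Op : Set c
  Op = Λ² k → Λ² k

  top bot : V k → Op
  top v = G v 𝟘
  bot v = G 𝟘 v

  -- The factor contributed by one element: `o` says whether its memberships in `U` and `V` are
  -- allowed, `s` and `t` whether it occurs as a top and as a bot.
  op : (o s t : Bool) → V k → Op
  op false s     t     v z = λ _ → 0#
  op true  false false v z = z
  op true  false true  v z = bot v z
  op true  true  false v z = top v z
  op true  true  true  v z = top v (bot v z)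

  op-linear : ∀ o s t v → IsLinear (op o s t v)
  op-linear false s     t     v = record
    { cong = λ _ _ → refl
    ; comb = λ a b x y j → solve 2 (λ a b → con (+ 0) := a :* con (+ 0) :+ b :* con (+ 0)) refl a b }
  op-linear true  false false v = record { cong = λ x≋y → x≋y ; comb = λ a b x y j → refl }
  op-linear true  false true  v = G-linear 𝟘 v
  op-linear true  true  false v = G-linear v 𝟘
  op-linear true  true  true  v = record
    { cong = λ x≋y → top.cong (bot.cong x≋y)
    ; comb = λ a b x y j → trans (top.cong (bot.comb a b x y) j) (top.comb a b _ _ j) }
    where
    module top = IsLinear (G-linear v 𝟘)
    module bot = IsLinear (G-linear 𝟘 v)

  ok : (p q x y u v : Bool) → Bool
  ok p q x y u v = imp u p ∧ (imp v q ∧ (imp x u ∧ imp y v))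

  -- The factors follow the order of the ground set, instead of all tops before all bots, so that
  -- sums over `U` and `V` can be evaluated element by element. The reordering costs only a sign.
  monomial : ∀ {n} → (Fin n → V k) → (P Q X Y U V S T : Subset n) → Λ² k
  monomial vs [] [] [] [] [] [] [] [] = 𝟙²
  monomial vs (p ∷ P) (q ∷ Q) (x ∷ X) (y ∷ Y) (u ∷ U) (v ∷ V) (s ∷ S) (t ∷ T) =
    op (ok p q x y u v) s t (vs zero) (monomial (vs ∘ suc) P Q X Y U V S T)

  record Admissible {n} (P Q X Y U V : Subset n) : Set where
    constructor admissible
    field
      U⊆P : U ⊆ P
      V⊆Q : V ⊆ Q
      X⊆U : X ⊆ U
      Y⊆V : Y ⊆ V

  IsProduct : ∀ {n} → (Fin n → V k) → (S T : Subset n) → Λ² k → Set (c ⊔ ℓ)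
  IsProduct vs S T z =
    Σ Carrier λ ε → IsSign ε × z ≋ (λ p → ε * μ 0# (wedge vs S) (wedge vs T) p)

  top-product : ∀ {n} (vs : Fin (suc n) → V k) S T {t z} →
    IsProduct vs (outside ∷ S) (t ∷ T) z → IsProduct vs (inside ∷ S) (t ∷ T) (top (vs zero) z)
  top-product vs S T {t} (ε , sign , eq) = ε , sign , λ p →
    trans (IsLinear.cong (G-linear v 𝟘) eq p) (trans (IsLinear.*-homo (G-linear v 𝟘) ε _ p)
      (*-congˡ (trans (G-cong (λ _ → refl) (λ i → sym (zeroˡ (v i))) (λ _ → refl) p) (G-μ-left 0# v _ _ p))))
    where v = vs zero

  -- Passing the product over `S` applies `bar` to it, which is a sign by `bar-wedge`.
  bot-product : ∀ {n} (vs : Fin (suc n) → V k) S T {z} →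
    IsProduct vs (outside ∷ S) (outside ∷ T) z → IsProduct vs (outside ∷ S) (inside ∷ T) (bot (vs zero) z)
  bot-product vs S T (ε , sign , eq) with bar-wedge (vs ∘ suc) S
  ... | δ , sign′ , eq′ = ε * δ , IsSign-* sign sign′ , λ p →
    trans (IsLinear.cong (G-linear 𝟘 v) eq p) (trans (IsLinear.*-homo (G-linear 𝟘 v) ε _ p)
      (trans (*-congˡ (trans (G-μ-right 0# v _ _ p) (trans (μ-cong 0# eq′ (λ _ → refl) p)
        (IsLinear.*-homo (μ-linearˡ 0# _) δ _ p)))) (sym (*-assoc ε δ _))))
    where v = vs zero

  op-product : ∀ {n} (vs : Fin (suc n) → V k) {o} s t S T {z} → o ≡ true →
    IsProduct (vs ∘ suc) S T z → IsProduct vs (s ∷ S) (t ∷ T) (op o s t (vs zero) z)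
  op-product vs false false S T ≡.refl pr = pr
  op-product vs false true  S T ≡.refl pr = bot-product vs S T pr
  op-product vs true  false S T ≡.refl pr = top-product vs S T {false} pr
  op-product vs true  true  S T ≡.refl pr = top-product vs S T {true} (bot-product vs S T pr)

  monomial-product : ∀ {n} (vs : Fin n → V k) P Q X Y U V S T →
    Admissible P Q X Y U V → IsProduct vs S T (monomial vs P Q X Y U V S T)
  monomial-product vs [] [] [] [] [] [] [] [] _ =
    1# , *-identityˡ 1# , λ p → trans (sym (μ-𝟙 0# p)) (sym (*-identityˡ _))
  monomial-product vs (p ∷ P) (q ∷ Q) (x ∷ X) (y ∷ Y) (u ∷ U) (v ∷ V) (s ∷ S) (t ∷ T) (admissible U⊆P V⊆Q X⊆U Y⊆V) =
    op-product vs s t S T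
      (≡.cong₂ _∧_ (⊆⇒imp U⊆P) (≡.cong₂ _∧_ (⊆⇒imp V⊆Q) (≡.cong₂ _∧_ (⊆⇒imp X⊆U) (⊆⇒imp Y⊆V))))
      (monomial-product (vs ∘ suc) P Q X Y U V S T
        (admissible (drop-∷-⊆ U⊆P) (drop-∷-⊆ V⊆Q) (drop-∷-⊆ X⊆U) (drop-∷-⊆ Y⊆V)))

  -- The inclusions are Boolean tests at each element, and one failed test annihilates the product,
  -- every `op` being linear.
  monomial-zero : ∀ {n} (vs : Fin n → V k) P Q X Y U V S T →
    monomial vs P Q X Y U V S T ≋ (λ _ → 0#) ⊎ Admissible P Q X Y U V
  monomial-zero vs [] [] [] [] [] [] [] [] =
    inj₂ (admissible ⊆-refl ⊆-refl ⊆-refl ⊆-refl)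
  monomial-zero vs (p ∷ P) (q ∷ Q) (x ∷ X) (y ∷ Y) (u ∷ U) (v ∷ V) (s ∷ S) (t ∷ T)
    with monomial-zero (vs ∘ suc) P Q X Y U V S T
  ... | inj₁ ≋0 = inj₁ (IsLinear.zero-homo (op-linear (ok p q x y u v) s t (vs zero)) ≋0)
  ... | inj₂ (admissible U⊆P V⊆Q X⊆U Y⊆V)
    with imp u p in up≡ | imp v q in vq≡ | imp x u in xu≡ | imp y v in yv≡
  ...   | true  | true  | true  | true  =
    inj₂ (admissible (imp⇒⊆ up≡ U⊆P) (imp⇒⊆ vq≡ V⊆Q) (imp⇒⊆ xu≡ X⊆U) (imp⇒⊆ yv≡ Y⊆V))
  ...   | false | _     | _     | _     = inj₁ (λ _ → refl)
  ...   | true  | false | _     | _     = inj₁ (λ _ → refl)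
  ...   | true  | true  | false | _     = inj₁ (λ _ → refl)
  ...   | true  | true  | true  | false = inj₁ (λ _ → refl)

  total : ∀ {n} → (Fin n → V k) → (P Q X Y A B W : Subset n) → Λ² k
  total vs P Q X Y A B W z = up (λ U → up (λ V → monomial vs P Q X Y U V ((A ─ U) ∪ V) ((B ─ V) ∪ U) z) ⊥) W

  infixl 6 _⊞_
  _⊞_ : Λ² k → Λ² k → Λ² k
  (z ⊞ z′) p = z p + z′ p

  -- The operator of the head is independent of the choices in the tail, so by linearity it leaves
  -- both sums.
  op-total : ∀ {n} (vs : Fin (suc n) → V k) P Q X Y A B W o s t →
    (λ j → up (λ U → up (λ V → op o s t (vs zero) (monomial (vs ∘ suc) P Q X Y U V ((A ─ U) ∪ V) ((B ─ V) ∪ U)) j) ⊥) W) ≋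
      op o s t (vs zero) (total (vs ∘ suc) P Q X Y A B W)
  op-total vs P Q X Y A B W o s t j = trans
    (up-cong (λ U → linear-up (op-linear o s t (vs zero)) (f U) ⊥ j) W)
    (linear-up (op-linear o s t (vs zero)) (λ U i → up (λ V → f U V i) ⊥) W j)
    where
    f : Subset _ → Subset _ → Λ² k
    f U V = monomial (vs ∘ suc) P Q X Y U V ((A ─ U) ∪ V) ((B ─ V) ∪ U)

  total-inside : ∀ {n} (vs : Fin (suc n) → V k) p q x y a b P Q X Y A B W →
    let z = total (vs ∘ suc) P Q X Y A B W in
    total vs (p ∷ P) (q ∷ Q) (x ∷ X) (y ∷ Y) (a ∷ A) (b ∷ B) (inside ∷ W) ≋
      op (ok p q x y true true) true true (vs zero) z ⊞ op (ok p q x y true false) false (b ∨ true) (vs zero) z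
  total-inside vs p q x y a b P Q X Y A B W j = trans (IsLinear.+-homo up-linear _ _ W)
    (+-cong (op-total vs P Q X Y A B W (ok p q x y true true) true true j)
      (op-total vs P Q X Y A B W (ok p q x y true false) false (b ∨ true) j))

  -- The summands put the head in both `U` and `V`, in `U` only, in `V` only, and in neither. A head
  -- in `W` leaves the first two, as in `total-inside`.
  total-outside : ∀ {n} (vs : Fin (suc n) → V k) p q x y a b P Q X Y A B W →
    let z = total (vs ∘ suc) P Q X Y A B W in
    total vs (p ∷ P) (q ∷ Q) (x ∷ X) (y ∷ Y) (a ∷ A) (b ∷ B) (outside ∷ W) ≋
      (op (ok p q x y true true) true true (vs zero) z ⊞ op (ok p q x y true false) false (b ∨ true) (vs zero) z)
      ⊞ (op (ok p q x y false true) (a ∨ true) false (vs zero) z ⊞ op (ok p q x y false false) (a ∨ false) (b ∨ false) (vs zero) z)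
  total-outside vs p q x y a b P Q X Y A B W j = +-cong (total-inside vs p q x y a b P Q X Y A B W j)
    (trans (IsLinear.+-homo up-linear _ _ W) (+-cong
      (op-total vs P Q X Y A B W (ok p q x y false true) (a ∨ true) false j)
      (op-total vs P Q X Y A B W (ok p q x y false false) (a ∨ false) (b ∨ false) j)))

  -- The span of the products of any element in the vectors eᵢ + fᵢ with the bots of some `T ⊆ R`.
  -- Since `x` is arbitrary, it absorbs scalars and signs.
  data Ideal {n} (vs : Fin n → V k) (R : Subset n) : Λ² k → Set (c ⊔ ℓ) where
    gen : ∀ {z} x T → T ⊆ R → z ≋ μ 1# x (wedge vs T) → Ideal vs R z
    sum : ∀ {z z₁ z₂} → Ideal vs R z₁ → Ideal vs R z₂ → z ≋ z₁ ⊞ z₂ → Ideal vs R z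

  module _ {n} {vs : Fin n → V k} {R : Subset n} where
    Ideal-resp : ∀ {z z′} → z′ ≋ z → Ideal vs R z → Ideal vs R z′
    Ideal-resp eq (gen x T T⊆R eq′) = gen x T T⊆R (λ p → trans (eq p) (eq′ p))
    Ideal-resp eq (sum i i′ eq′)    = sum i i′ (λ p → trans (eq p) (eq′ p))

    infixl 6 _⊕_
    _⊕_ : ∀ {z z′} → Ideal vs R z → Ideal vs R z′ → Ideal vs R (z ⊞ z′)
    i ⊕ i′ = sum i i′ (λ _ → refl)

    Ideal-zero : Ideal vs R (λ _ → 0#)
    Ideal-zero = gen (λ _ → 0#) R ⊆-refl (λ p → sym (IsLinear.zero-homo (μ-linearˡ 1# _) (λ _ → refl) p))

    Ideal-neg : ∀ {z} → Ideal vs R z → Ideal vs R (λ p → - z p)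
    Ideal-neg (gen x T T⊆R eq) = gen (λ S → - x S) T T⊆R
      (λ p → trans (-‿cong (eq p)) (sym (IsLinear.neg-homo (μ-linearˡ 1# _) x p)))
    Ideal-neg (sum i i′ eq)    = sum (Ideal-neg i) (Ideal-neg i′)
      (λ p → trans (-‿cong (eq p)) (solve 2 (λ a b → :- (a :+ b) := :- a :+ :- b) refl _ _))

    -- By `μ-⊤` the leading coefficient of a generator contains that of `wedge vs T` as a factor.
    Ideal-⊤ : (∀ T → T ⊆ R → wedge vs T ⊤ ≈ 0#) → ∀ {z} → Ideal vs R z → z (⊤ , ⊤) ≈ 0#
    Ideal-⊤ h (gen x T T⊆R eq) with μ-⊤ k
    ... | ε , _ , μ-eq = trans (eq _) (trans (μ-eq 1# x (wedge vs T))
      (trans (*-congˡ (trans (*-congˡ (h T T⊆R)) (zeroʳ _))) (zeroʳ ε)))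
    Ideal-⊤ h (sum i i′ eq) = trans (eq _) (trans (+-cong (Ideal-⊤ h i) (Ideal-⊤ h i′)) (+-identityˡ 0#))

  diag : V k → Op
  diag v = G v v

  module _ {n} {vs : Fin (suc n) → V k} {R : Subset n} where
    Ideal-tail : ∀ {r z} → Ideal (vs ∘ suc) R z → Ideal vs (r ∷ R) z
    Ideal-tail (gen x T T⊆R eq) = gen x (outside ∷ T) (out⊆ T⊆R) eq
    Ideal-tail (sum i i′ eq)    = sum (Ideal-tail i) (Ideal-tail i′) eq

    -- A diag is absorbed by the arbitrary first factor, so the head may be in the index set or not.
    Ideal-diag : ∀ {r z} → Ideal vs (r ∷ R) z → Ideal vs (r ∷ R) (diag (vs zero) z)
    Ideal-diag (gen x T T⊆R eq) = gen (W (vs zero) x) T T⊆R (λ p →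
      trans (G-cong (λ _ → refl) (λ i → sym (*-identityˡ _)) eq p) (G-μ-left 1# (vs zero) x _ p))
    Ideal-diag (sum i i′ eq) = sum (Ideal-diag i) (Ideal-diag i′) (λ p →
      trans (IsLinear.cong (G-linear (vs zero) (vs zero)) eq p) (IsLinear.+-homo (G-linear (vs zero) (vs zero)) _ _ p))

    -- A bot passes the first factor and joins the second, hence the `inside`; if the column is
    -- already there, the product is zero by `W-W`.
    Ideal-bot : ∀ {z} → Ideal vs (inside ∷ R) z → Ideal vs (inside ∷ R) (bot (vs zero) z)
    Ideal-bot (gen x (outside ∷ T) T⊆R eq) = gen (bar x) (inside ∷ T) (in⊆in (drop-∷-⊆ T⊆R)) (λ p →
      trans (IsLinear.cong (G-linear 𝟘 (vs zero)) eq p) (G-μ-right 1# (vs zero) x _ p))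
    Ideal-bot (gen x (inside ∷ T) T⊆R eq) = Ideal-resp (λ p →
      trans (IsLinear.cong (G-linear 𝟘 (vs zero)) eq p) (trans (G-μ-right 1# (vs zero) x _ p)
        (IsLinear.zero-homo (μ-linearʳ 1# (bar x)) (W-W (vs zero) _) p))) Ideal-zero
    Ideal-bot (sum i i′ eq) = sum (Ideal-bot i) (Ideal-bot i′) (λ p →
      trans (IsLinear.cong (G-linear 𝟘 (vs zero)) eq p) (IsLinear.+-homo (G-linear 𝟘 (vs zero)) _ _ p))

    -- A top is the diag minus the bot.
    Ideal-top : ∀ {z} → Ideal vs (inside ∷ R) z → Ideal vs (inside ∷ R) (top (vs zero) z)
    Ideal-top i = sum (Ideal-diag i) (Ideal-neg (Ideal-bot i)) (λ p → sym
      (trans (+-congʳ (G-diag (vs zero) _ p)) (solve 2 (λ a b → a :+ b :- b := a) refl _ _)))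

    Ideal-op : ∀ o s t {z} → Ideal (vs ∘ suc) R z → Ideal vs (inside ∷ R) (op o s t (vs zero) z)
    Ideal-op false s     t     i = Ideal-zero
    Ideal-op true  false false i = Ideal-tail i
    Ideal-op true  false true  i = Ideal-bot (Ideal-tail i)
    Ideal-op true  true  false i = Ideal-top (Ideal-tail i)
    Ideal-op true  true  true  i = Ideal-top (Ideal-bot (Ideal-tail i))

  -- For an element of only one of A and B outside W, X and Y, the two surviving
  -- operators are top v and bot v, whose sum diag v preserves the second factor.
  total-ideal : ∀ {n} (vs : Fin n → V k) X Y A B W →
    Ideal vs ((X ∪ Y) ∪ (W ∪ (A ∩ B))) (total vs (A ─ B) (B ─ A) X Y A B W)
  -- For a head in the index set every operator is admissible by `Ideal-op`, so its memberships need
  -- no case distinction beyond `w`.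
  total-ideal-inside : ∀ {n} (vs : Fin (suc n) → V k) x y a b w X Y A B W →
    Ideal vs (inside ∷ ((X ∪ Y) ∪ (W ∪ (A ∩ B)))) (total vs ((a ∷ A) ─ (b ∷ B)) ((b ∷ B) ─ (a ∷ A)) (x ∷ X) (y ∷ Y) (a ∷ A) (b ∷ B) (w ∷ W))

  total-ideal-inside vs x y a b true X Y A B W = Ideal-resp
    (total-inside vs p q x y a b (A ─ B) (B ─ A) X Y A B W)
    (Ideal-op (ok p q x y true true) true true i ⊕ Ideal-op (ok p q x y true false) false (b ∨ true) i)
    where
    i = total-ideal (vs ∘ suc) X Y A B W
    p = head ((a ∷ A) ─ (b ∷ B))
    q = head ((b ∷ B) ─ (a ∷ A))
  total-ideal-inside vs x y a b false X Y A B W = Ideal-resp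
    (total-outside vs p q x y a b (A ─ B) (B ─ A) X Y A B W)
    ((Ideal-op (ok p q x y true true) true true i ⊕ Ideal-op (ok p q x y true false) false (b ∨ true) i)
      ⊕ (Ideal-op (ok p q x y false true) (a ∨ true) false i ⊕ Ideal-op (ok p q x y false false) (a ∨ false) (b ∨ false) i))
    where
    i = total-ideal (vs ∘ suc) X Y A B W
    p = head ((a ∷ A) ─ (b ∷ B))
    q = head ((b ∷ B) ─ (a ∷ A))

  total-ideal vs [] [] [] [] [] = gen 𝟙 [] ⊆-refl (λ p → sym (μ-𝟙 1# p))
  total-ideal vs (true ∷ X) (y ∷ Y) (a ∷ A) (b ∷ B) (w ∷ W) =
    total-ideal-inside vs true y a b w X Y A B W
  total-ideal vs (false ∷ X) (true ∷ Y) (a ∷ A) (b ∷ B) (w ∷ W) =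
    total-ideal-inside vs false true a b w X Y A B W
  total-ideal vs (false ∷ X) (false ∷ Y) (a ∷ A) (b ∷ B) (true ∷ W) =
    total-ideal-inside vs false false a b true X Y A B W
  total-ideal vs (false ∷ X) (false ∷ Y) (true ∷ A) (true ∷ B) (false ∷ W) =
    total-ideal-inside vs false false true true false X Y A B W
  total-ideal vs (false ∷ X) (false ∷ Y) (true ∷ A) (false ∷ B) (false ∷ W) = Ideal-resp
    (λ p → trans (total-outside vs true false false false true false (A ─ B) (B ─ A) X Y A B W p)
      (trans (solve 2 (λ a b → con (+ 0) :+ b :+ (con (+ 0) :+ a) := a :+ b) refl _ _) (sym (G-diag (vs zero) _ p))))
    (Ideal-diag (Ideal-tail (total-ideal (vs ∘ suc) X Y A B W)))
  total-ideal vs (false ∷ X) (false ∷ Y) (false ∷ A) (true ∷ B) (false ∷ W) = Ideal-resp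
    (λ p → trans (total-outside vs false true false false false true (A ─ B) (B ─ A) X Y A B W p)
      (trans (solve 2 (λ a b → con (+ 0) :+ con (+ 0) :+ (a :+ b) := a :+ b) refl _ _) (sym (G-diag (vs zero) _ p))))
    (Ideal-diag (Ideal-tail (total-ideal (vs ∘ suc) X Y A B W)))
  total-ideal vs (false ∷ X) (false ∷ Y) (false ∷ A) (false ∷ B) (false ∷ W) = Ideal-resp
    (λ p → trans (total-outside vs false false false false false false (A ─ B) (B ─ A) X Y A B W p)
      (solve 1 (λ a → con (+ 0) :+ con (+ 0) :+ (con (+ 0) :+ a) := a) refl _))
    (Ideal-tail (total-ideal (vs ∘ suc) X Y A B W))

-- Vanishing of the weighted sum and its only surviving pair.

module UniqueExchange {c ℓ} (F : Field c ℓ) (char : CharZero F) {r n : ℕ} (M : Fin r → Fin n → Field.Carrier F)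
                      (A B X Y : Subset n) where
  open Field F hiding (zero)
  open Exterior F
  open Products F
  open SubsetSums F
  open SubsetProperties
  open Bracket F M
  open Exchange F {r}

  term : Subset n → Subset n → Carrier
  term U V = monomial column (A ─ B) (B ─ A) X Y U V ((A ─ U) ∪ V) ((B ─ V) ∪ U) (⊤ , ⊤)

  term-product : ∀ {U V} → Admissible (A ─ B) (B ─ A) X Y U V →
    Σ Carrier λ ε → IsSign ε × term U V ≈ ε * ([ (A ─ U) ∪ V ] * [ (B ─ V) ∪ U ])
  term-product {U} {V} adm
    with monomial-product column (A ─ B) (B ─ A) X Y U V ((A ─ U) ∪ V) ((B ─ V) ∪ U) adm | μ-⊤ r
  ... | ε , sign , eq | δ , sign′ , μ-eq = ε * δ , IsSign-* sign sign′ ,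
    trans (eq _) (trans (*-congˡ (μ-eq 0# _ _)) (sym (*-assoc ε δ _)))

  term-zero : ∀ U V →
    (Admissible (A ─ B) (B ─ A) X Y U V → [ (A ─ U) ∪ V ] * [ (B ─ V) ∪ U ] ≈ 0#) → term U V ≈ 0#
  term-zero U V h with monomial-zero column (A ─ B) (B ─ A) X Y U V ((A ─ U) ∪ V) ((B ─ V) ∪ U)
  ... | inj₁ ≋0 = ≋0 _
  ... | inj₂ adm with term-product adm
  ...   | ε , _ , eq = trans eq (trans (*-congˡ (h adm)) (zeroʳ ε))

  -- A set `T` of size `r` inside the index set has at most `d` elements from `W` and at most
  -- `∣ A ∩ B ∣` from `A ∩ B`. At least `suc k` of its elements are then in `X ∪ Y`, and `h`
  -- applies.
  vanishes : ∀ k d → (∀ T → k < ∣ (X ∪ Y) ∩ T ∣ → [ T ] ≈ 0#) → r ≡ suc k ℕ.+ d ℕ.+ ∣ A ∩ B ∣ →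
    Vanishes (λ U → up (term U) ⊥) d
  vanishes k d h r≡ W ∣W∣≤d = Ideal-⊤ bracket-zero (total-ideal column X Y A B W)
    where
    bracket-zero : ∀ T → T ⊆ (X ∪ Y) ∪ (W ∪ (A ∩ B)) → [ T ] ≈ 0#
    bracket-zero T T⊆ with ∣ T ∣ ℕ.≟ r
    ... | no  ≢r = []-degree T ≢r
    ... | yes ≡r = h T (ℕₚ.+-cancelʳ-≤ (d ℕ.+ ∣ A ∩ B ∣) (suc k) (∣ (X ∪ Y) ∩ T ∣) (begin
      suc k ℕ.+ (d ℕ.+ ∣ A ∩ B ∣)                       ≡⟨ ℕₚ.+-assoc (suc k) d ∣ A ∩ B ∣ ⟨
      suc k ℕ.+ d ℕ.+ ∣ A ∩ B ∣                         ≡⟨ ≡.trans ≡r r≡ ⟨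
      ∣ T ∣                                             ≤⟨ ∣∣-cover T (X ∪ Y) W (A ∩ B) T⊆ ⟩
      ∣ (X ∪ Y) ∩ T ∣ ℕ.+ (∣ W ∣ ℕ.+ ∣ A ∩ B ∣)         ≤⟨ ℕₚ.+-monoʳ-≤ ∣ (X ∪ Y) ∩ T ∣ (ℕₚ.+-monoˡ-≤ ∣ A ∩ B ∣ ∣W∣≤d) ⟩
      ∣ (X ∪ Y) ∩ T ∣ ℕ.+ (d ℕ.+ ∣ A ∩ B ∣)             ∎))
      where open ℕₚ.≤-Reasoning

  -- Uniqueness as the vanishing of products, the form the sum needs. The hypothesis about bases
  -- yields it only under a double negation.
  Unique : ℕ → Subset n → Subset n → Set ℓ
  Unique k U₀ V₀ = ∀ U V → Admissible (A ─ B) (B ─ A) X Y U V → ∣ U ∣ ≡ ∣ V ∣ → ∣ U ∣ ≤ k →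
    ¬ (U ≡ U₀ × V ≡ V₀) → [ (A ─ U) ∪ V ] * [ (B ─ V) ∪ U ] ≈ 0#

  -- With H u = (u - k - 1) ⋯ (u - (∣ A ─ B ∣ - 1)), the sum of H ∣ U ∣ * term U V over all
  -- U and V vanishes; in it only the term of U₀ and V₀ is possibly nonzero.
  [B]*[A]≉0 : ∀ {k U₀ V₀} → ∣ A ∣ ≡ r → ∣ B ∣ ≡ r → k < ∣ A ─ B ∣ →
    (∀ T → k < ∣ (X ∪ Y) ∩ T ∣ → [ T ] ≈ 0#) → Unique k U₀ V₀ →
    Admissible (A ─ B) (B ─ A) X Y U₀ V₀ → ∣ U₀ ∣ ≤ k →
    ¬ ([ (A ─ U₀) ∪ V₀ ] ≈ 0#) → ¬ ([ (B ─ V₀) ∪ U₀ ] ≈ 0#) → ¬ ([ B ] * [ A ] ≈ 0#)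
  [B]*[A]≉0 {k} {U₀} {V₀} ∣A∣≡r ∣B∣≡r k<m h uniq adm₀ ∣U₀∣≤k S₀≉0 T₀≉0 BA≈0 with term-product adm₀
  -- Cancel the weight, the sign and the first bracket in turn.
  ... | ε , sign , eq = T₀≉0 (x*y≈0⇒y≈0 S₀≉0 (x*y≈0⇒y≈0 ε≉0 (trans (sym eq) (x*y≈0⇒y≈0 weight₀≉0 weighted₀≈0))))
    where
    m = ∣ A ─ B ∣
    -- One linear factor for each size strictly between `k` and `m`; by `k<m` the subtraction is
    -- exact.
    d = m ℕ.∸ suc k

    m≡ : suc k ℕ.+ d ≡ m
    m≡ = ℕₚ.m+[n∸m]≡n k<m

    H : ℕ → Carrier
    H = weight d (suc k)

    weight₀≉0 : ¬ (H ∣ U₀ ∣ ≈ 0#)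
    weight₀≉0 = weight-nonzero char d (suc k) ∣ U₀ ∣ (ℕ.s≤s ∣U₀∣≤k)

    ε≉0 : ¬ (ε ≈ 0#)
    ε≉0 ε≈0 = 0≉1 (trans (sym (zeroˡ ε)) (trans (*-congʳ (sym ε≈0)) sign))

    r≡ : r ≡ suc k ℕ.+ d ℕ.+ ∣ A ∩ B ∣
    r≡ = ≡.trans (≡.sym ∣A∣≡r) (≡.trans (∣p∣≡∣p─q∣+∣p∩q∣ A B) (≡.cong (ℕ._+ ∣ A ∩ B ∣) (≡.sym m≡)))

    ∣A─B∣≡∣B─A∣ : ∣ A ─ B ∣ ≡ ∣ B ─ A ∣
    ∣A─B∣≡∣B─A∣ = ℕₚ.+-cancelʳ-≡ (∣ A ∩ B ∣) (∣ A ─ B ∣) (∣ B ─ A ∣)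
      (≡.trans (≡.sym (∣p∣≡∣p─q∣+∣p∩q∣ A B)) (≡.trans ∣A∣≡r (≡.trans (≡.sym ∣B∣≡r)
        (≡.trans (∣p∣≡∣p─q∣+∣p∩q∣ B A) (≡.cong (λ S → ∣ B ─ A ∣ ℕ.+ ∣ S ∣) (∩-comm B A))))))

    weighted-zero : ∀ U V → ¬ (U ≡ U₀ × V ≡ V₀) → H ∣ U ∣ * term U V ≈ 0#
    weighted-zero U V ≢ with ∣ U ∣ ℕ.≤? k
    -- If `∣ U ∣` and `∣ V ∣` agree, uniqueness applies; otherwise the first exchanged set does not
    -- have size `r`.
    ... | yes ∣U∣≤k = trans (*-congˡ (term-zero U V product-zero)) (zeroʳ _)
      where
      product-zero : Admissible (A ─ B) (B ─ A) X Y U V → [ (A ─ U) ∪ V ] * [ (B ─ V) ∪ U ] ≈ 0#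
      product-zero adm with ∣ U ∣ ℕ.≟ ∣ V ∣
      ... | yes eq = uniq U V adm eq ∣U∣≤k ≢
      ... | no  ≢  = trans (*-congʳ ([]-degree ((A ─ U) ∪ V) (λ ≡r → ≢ (ℕₚ.+-cancelˡ-≡ r (∣ U ∣) (∣ V ∣)
        (≡.trans (≡.cong (ℕ._+ ∣ U ∣) (≡.sym ≡r)) (≡.trans
          (∣[p─u]∪v∣+∣u∣≡∣p∣+∣v∣ A B U V (p─q⊆p A B ∘ Admissible.U⊆P adm) (Admissible.V⊆Q adm))
          (≡.cong (ℕ._+ ∣ V ∣) ∣A∣≡r))))))) (zeroˡ _)
    ... | no ∣U∣≰k with ∣ U ∣ ℕ.<? m
    ...   | yes ∣U∣<m = trans (*-congʳ (weight-zero d (suc k) ∣ U ∣ (ℕₚ.≰⇒> ∣U∣≰k) (≡.subst (∣ U ∣ <_) (≡.sym m≡) ∣U∣<m))) (zeroˡ _)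
    -- Here `U` is all of `A ─ B`. Either `V` is all of `B ─ A`, giving `[ B ] * [ A ]`, or the
    -- first exchanged set has the wrong size.
    ...   | no  ∣U∣≮m = trans (*-congˡ (term-zero U V product-zero)) (zeroʳ _)
      where
      product-zero : Admissible (A ─ B) (B ─ A) X Y U V → [ (A ─ U) ∪ V ] * [ (B ─ V) ∪ U ] ≈ 0#
      product-zero adm with ⊆∧∣∣≥⇒≡ (Admissible.U⊆P adm) (ℕₚ.≮⇒≥ ∣U∣≮m) | ∣ V ∣ ℕ.≟ ∣ B ─ A ∣
      ... | ≡.refl | yes ∣V∣≡ with ⊆∧∣∣≥⇒≡ (Admissible.V⊆Q adm) (ℕₚ.≤-reflexive (≡.sym ∣V∣≡))
      ...   | ≡.refl = trans (reflexive (≡.cong₂ (λ S T → [ S ] * [ T ]) ([p─[p─q]]∪[q─p]≡q A B) ([p─[p─q]]∪[q─p]≡q B A))) BA≈0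
      product-zero adm | ≡.refl | no ∣V∣≢ = trans (*-congʳ ([]-degree ((A ─ U) ∪ V) (λ ≡r → ∣V∣≢ (ℕₚ.+-cancelˡ-≡ r (∣ V ∣) (∣ B ─ A ∣)
        (≡.trans (≡.trans (≡.cong (ℕ._+ ∣ V ∣) (≡.sym ∣A∣≡r)) (≡.sym
          (∣[p─u]∪v∣+∣u∣≡∣p∣+∣v∣ A B U V (p─q⊆p A B ∘ Admissible.U⊆P adm) (Admissible.V⊆Q adm))))
          (≡.cong₂ ℕ._+_ ≡r ∣A─B∣≡∣B─A∣)))))) (zeroˡ _)

    weighted₀≈0 : H ∣ U₀ ∣ * term U₀ V₀ ≈ 0#
    weighted₀≈0 = begin
      -- At `⊥` the sum `up` runs over all subsets, and both sums collapse to their only possibly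
      -- nonzero summand.
      H ∣ U₀ ∣ * term U₀ V₀                      ≈⟨ up-single (λ V → H ∣ U₀ ∣ * term U₀ V) V₀ (λ V ≢ → weighted-zero U₀ V (≢ ∘ proj₂)) ⟨
      up (λ V → H ∣ U₀ ∣ * term U₀ V) ⊥          ≈⟨ IsLinear.*-homo up-linear (H ∣ U₀ ∣) (term U₀) ⊥ ⟩
      H ∣ U₀ ∣ * up (term U₀) ⊥                  ≈⟨ up-single (λ U → H ∣ U ∣ * up (term U) ⊥) U₀ (λ U ≢ →
                                                      trans (sym (IsLinear.*-homo up-linear (H ∣ U ∣) (term U) ⊥))
                                                        (IsLinear.zero-homo up-linear (λ V → weighted-zero U V (≢ ∘ proj₁)) ⊥)) ⟨
      up (λ U → H ∣ U ∣ * up (term U) ⊥) ⊥       ≈⟨ vanishes-weight _ d (suc k) (vanishes k d h r≡) ⊥ (ℕₚ.≤-reflexive (∣⊥∣≡0 n)) ⟩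
      0#                                         ∎
      where open Relation.Binary.Reasoning.Setoid setoid

-- From brackets back to bases and rank.

theorem1p11 : ∀ {c ℓ} (F : Field c ℓ) → CharZero F →
    ∀ {r n : ℕ} (M : Fin r → Fin n → Field.Carrier F) →
    let open Represented F M in
    ∀ (A B X Y : Subset n) (rE rXY : ℕ) →
    IsRank ⊤ rE → ∣ A ∣ ≡ rE → ∣ B ∣ ≡ rE →
    X ⊆ A ─ B → Y ⊆ B ─ A →
    IsRank (X ∪ Y) rXY → rXY < ∣ A ─ B ∣ →
    let P : Subset n → Subset n → Set ℓ
        P U V = U ⊆ A ─ B × V ⊆ B ─ A × X ⊆ U × Y ⊆ V
                × ∣ U ∣ ≡ ∣ V ∣ × ∣ U ∣ ≤ rXY
                × IsBasis ((A ─ U) ∪ V) × IsBasis ((B ─ V) ∪ U)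
    in
    (Σ (Subset n) λ U → Σ (Subset n) λ V →
       P U V × (∀ U′ V′ → P U′ V′ → U′ ≡ U × V′ ≡ V)) →
    IsBasis A × IsBasis B
theorem1p11 F char {r} {n} M A B X Y rE rXY ((E , E-basis , ∣⊤∩E∣≡rE) , _) ∣A∣≡rE ∣B∣≡rE X⊆ Y⊆ (_ , rXY-max) rXY<m
  (U₀ , V₀ , (U₀⊆ , V₀⊆ , X⊆U₀ , Y⊆V₀ , _ , ∣U₀∣≤ , S₀-basis , T₀-basis) , unique) =
    []≉0⇒basis (λ A≈0 → BA≉0 (trans (*-congˡ A≈0) (zeroʳ _))) ,
    []≉0⇒basis (λ B≈0 → BA≉0 (trans (*-congʳ B≈0) (zeroˡ _)))
  where
  open Field F hiding (zero)
  open Represented F M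
  open Bracket F M
  open SubsetProperties
  open Exchange F {r} using (Admissible; admissible)
  open UniqueExchange F char M A B X Y

  -- The rank of the ground set is attained at a basis, and every basis has as many elements as `M`
  -- has rows.
  rE≡r : rE ≡ r
  rE≡r = ≡.trans (≡.sym ∣⊤∩E∣≡rE) (≡.trans (≡.cong ∣_∣ (∩-identityˡ E)) (basis⇒∣∣≡r E-basis))

  -- Equality in `F` need not be decidable, so a set that cannot be a basis has bracket zero only up
  -- to double negation.
  ¬¬large : ¬ ¬ (∀ T → rXY < ∣ (X ∪ Y) ∩ T ∣ → [ T ] ≈ 0#)
  ¬¬large = ¬¬-∀ (λ T → ¬¬-→ (λ lt ≉0 → ℕₚ.<⇒≱ lt (rXY-max T ([]≉0⇒basis ≉0))))

  -- A nonzero product has two nonzero brackets, so both exchanged sets would be bases and the pair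
  -- would have to be the given one.
  ¬¬unique : ¬ ¬ (Unique rXY U₀ V₀)
  ¬¬unique = ¬¬-∀ λ U → ¬¬-∀ λ V →
    ¬¬-→ λ adm → ¬¬-→ λ eq → ¬¬-→ λ le → ¬¬-→ λ ≢ ≉0 → ≢ (unique U V
      ( Admissible.U⊆P adm , Admissible.V⊆Q adm , Admissible.X⊆U adm , Admissible.Y⊆V adm , eq , le
      , []≉0⇒basis (λ ≈0 → ≉0 (trans (*-congʳ ≈0) (zeroˡ _)))
      , []≉0⇒basis (λ ≈0 → ≉0 (trans (*-congˡ ≈0) (zeroʳ _)))))

  BA≉0 : ¬ ([ B ] * [ A ] ≈ 0#)
  -- The goal is a negation, so both double negations can be stripped.
  BA≉0 BA≈0 = ¬¬large λ large → ¬¬unique λ uniq →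
    [B]*[A]≉0 (≡.trans ∣A∣≡rE rE≡r) (≡.trans ∣B∣≡rE rE≡r) rXY<m large uniq
      (admissible U₀⊆ V₀⊆ X⊆U₀ Y⊆V₀) ∣U₀∣≤ (basis⇒[]≉0 S₀-basis) (basis⇒[]≉0 T₀-basis) BA≈0
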